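{- Let $\alpha>0$ and $d\ge1$. (1) For the exponential kernel $K_e^{(\alpha)}(x,y)=\exp(-\alpha(1-\langle x,y\rangle))$ on the unit sphere $S^d\subset\mathbb{R}^{d+1}$, every finite family $x_1,\dots,x_n\in S^d$ has a signing $\sigma\in\{\pm1\}^n$ with $\sup_{y\in S^d}|\sum_i\sigma_iK_e^{(\alpha)}(x_i,y)|\le f_{\mathrm T}(d+1)+1$. (2) For the Hellinger kernel $\exp(-\alpha\|\sqrt x-\sqrt y\|^2)$ (square roots coordinatewise) on the probability simplex in $\mathbb{R}^d$, every finite family $x_1,\dots,x_n$ in the simplex has a signing $\sigma\in\{\pm1\}^n$ with $\sup_y|\sum_i\sigma_i\exp(-\alpha\|\sqrt{x_i}-\sqrt y\|^2)|\le f_{\mathrm T}(d)+1$, the supremum being over the simplex. Both bounds are uniform in $\alpha$ and $n$. Consequently both kernels have coreset complexity $O_d(1/\varepsilon)$, uniformly in $\alpha$: for every finite family of points $x_1,\dots,x_n$ of the domain and every $\varepsilon\in(0,1]$ there is $S\subseteq[n]$ with $|S|=O_d(1/\varepsilon)$ and $\sup_y\bigl|\frac1{|S|}\sum_{i\in S}K(x_i,y)-\frac1n\sum_{i=1}^nK(x_i,y)\bigr|\le\varepsilon$, where $K$ is the kernel and $y$ ranges over its domain.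
   Context: Tai's constant: let $T(x,p)=e^{ -\|x-p\|^2}$ on $\mathbb{R}^D$. Partition $\mathbb{R}^D$ into cells of side two centred at the points $g\in(2\mathbb{Z})^D$. By a theorem of Tai there is a constant $C_D$ depending only on $D$ such that for every finite $P\subset\mathbb{R}^D$, with $Q_g$ the part of $P$ in the cell of $g$, each $Q_g$ has a signing $\sigma_g\in\{\pm1\}^{Q_g}$ with $|\sum_{p\in Q_g}\sigma_g(p)T(x,p)|\le C_De^{ -\|x-g\|^2/3}$ for all $x\in\mathbb{R}^D$ and $|\sum_{p\in Q_g}\sigma_g(p)|\le1$. The constant $f_{\mathrm T}(D)$ is the resulting finite upper bound, depending only on $D$, for $\sup_x\sum_g C_De^{ -\|x-g\|^2/3}$ (obtained by summing over shells of cells via the convergent series $\sum_{r\ge1}(2r+1)^De^{ -4(r-1)^2/3}$); thus every finite $P\subset\mathbb{R}^D$ has a signing $\sigma$ with $\sup_{x\in\mathbb{R}^D}|\sum_{p\in P}\sigma(p)T(x,p)|\le f_{\mathrm T}(D)$. -}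

module Defs where

open import Level using (0ℓ) renaming (suc to lsuc)
open import Algebra.Bundles using (CommutativeRing)
open import Axiom.ExcludedMiddle using (ExcludedMiddle)
open import Data.Bool.Base using (if_then_else_)
open import Data.Fin.Base using (Fin; toℕ)
open import Data.Fin.Subset using (Subset; Nonempty) renaming (∣_∣ to card)
open import Data.Integer.Base using (ℤ; +_; -[1+_])
open import Data.Nat.Base as ℕ using (ℕ; zero; suc; NonZero; _!)
open import Data.Product.Base using (∃; _×_; _,_)
open import Data.Sign.Base as Sign using (Sign)
open import Data.Sum.Base using (inj₁; inj₂)
open import Data.Vec.Base using (Vec; lookup; tabulate)
open import Data.Vec.Functional using (Vector)
open import Function.Definitions using (Injective)
open import Relation.Binary.Core using (Rel)
open import Relation.Binary.PropositionalEquality.Core using (_≡_)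
open import Relation.Binary.Structures using (IsTotalOrder)
open import Relation.Nullary.Decidable.Core using (yes; no; does)
open import Relation.Nullary.Negation.Core using (¬_)
import Algebra.Properties.Semiring.Exp as Exp
import Algebra.Properties.Semiring.Mult as Mult
import Algebra.Properties.Semiring.Sum as Sum
import Data.Vec.Functional.Relation.Binary.Equality.Setoid as VecEquality
import Relation.Binary.Construct.NonStrictToStrict as NonStrictToStrict

-- The real numbers, given axiomatically.  Classically these axioms determine
-- the structure up to unique isomorphism.
record CompleteOrderedField : Set (lsuc 0ℓ) where
  infix 4 _≤_
  field
    commutativeRing : CommutativeRing 0ℓ 0ℓ

  open CommutativeRing commutativeRing public
    renaming (Carrier to ℝ; zero to *-zero)

  field
    _≤_          : Rel ℝ 0ℓ
    isTotalOrder : IsTotalOrder _≈_ _≤_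
    +-monoˡ-≤    : ∀ z {x y} → x ≤ y → x + z ≤ y + z
    *-nonNeg     : ∀ {x y} → 0# ≤ x → 0# ≤ y → 0# ≤ x * y
    1≉0          : ¬ (1# ≈ 0#)
    inverse      : ∀ x → ¬ (x ≈ 0#) → ∃ λ y → x * y ≈ 1#

  UpperBound : (ℝ → Set) → ℝ → Set
  UpperBound P b = ∀ x → P x → x ≤ b

  field
    supremum : (P : ℝ → Set) → ∃ P → ∃ (UpperBound P) →
               ∃ λ s → UpperBound P s × (∀ b → UpperBound P b → s ≤ b)

module Analysis (em : ExcludedMiddle 0ℓ) (reals : CompleteOrderedField) where

  open CompleteOrderedField reals public
  open IsTotalOrder isTotalOrder public using (total)
  open NonStrictToStrict _≈_ _≤_ public using (_<_)
  open Exp semiring public using (_^_)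
  open Mult semiring public using () renaming (_×_ to _×ℕ_)
  open Sum semiring public using (sum; sum-syntax)

  infix  8 _⁻¹
  infixl 7 _/_

  fromℕ : ℕ → ℝ
  fromℕ n = n ×ℕ 1#

  fromℤ : ℤ → ℝ
  fromℤ (+ n)    = fromℕ n
  fromℤ -[1+ n ] = - fromℕ (suc n)

  fromSign : Sign → ℝ
  fromSign Sign.+ = 1#
  fromSign Sign.- = - 1#

  ∣_∣ : ℝ → ℝ
  ∣ x ∣ with total 0# x
  ... | inj₁ _ = x
  ... | inj₂ _ = - x

  -- Some x with P x, or the junk value 0# if there is none.  Below, P always
  -- determines x up to _≈_.
  the : (ℝ → Set) → ℝ
  the P with em {∃ P}
  ... | yes (x , _) = x
  ... | no  _       = 0#

  _⁻¹ : ℝ → ℝ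
  x ⁻¹ = the (λ y → x * y ≈ 1#)

  _/_ : ℝ → ℝ → ℝ
  x / y = x * y ⁻¹

  √ : ℝ → ℝ
  √ x = the (λ y → 0# ≤ y × y * y ≈ x)

  ConvergesTo : (ℕ → ℝ) → ℝ → Set
  ConvergesTo s l = ∀ ε → 0# < ε → ∃ λ N → ∀ n → N ℕ.≤ n → ∣ s n - l ∣ < ε

  limit : (ℕ → ℝ) → ℝ
  limit s = the (ConvergesTo s)

  exp : ℝ → ℝ
  exp x = limit (λ n → ∑[ k < n ] (x ^ toℕ k / fromℕ (toℕ k !)))

  ------------------------------------------------------------------------
  -- Euclidean space

  ℝ^_ : ℕ → Set
  ℝ^ D = Vector ℝ D

  open VecEquality setoid public using (_≋_)

  infixl 6 _∸ᵛ_

  _∸ᵛ_ : ∀ {D} → ℝ^ D → ℝ^ D → ℝ^ D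
  (x ∸ᵛ y) j = x j - y j

  ⟨_,_⟩ : ∀ {D} → ℝ^ D → ℝ^ D → ℝ
  ⟨_,_⟩ {D} x y = ∑[ j < D ] (x j * y j)

  ‖_‖ : ∀ {D} → ℝ^ D → ℝ
  ‖ x ‖ = √ ⟨ x , x ⟩

  √ᵛ : ∀ {D} → ℝ^ D → ℝ^ D
  √ᵛ x j = √ (x j)

  Sphere : ∀ d → ℝ^ (suc d) → Set
  Sphere d x = ‖ x ‖ ≈ 1#

  Simplex : ∀ d → ℝ^ d → Set
  Simplex d x = (∀ j → 0# ≤ x j) × sum x ≈ 1#

  ------------------------------------------------------------------------
  -- Kernels

  Kernel : ℕ → Set
  Kernel D = ℝ^ D → ℝ^ D → ℝ

  T : ∀ {D} → Kernel D
  T x p = exp (- (‖ x ∸ᵛ p ‖ ^ 2))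

  exponentialKernel : ℝ → ∀ {D} → Kernel D
  exponentialKernel α x y = exp (- (α * (1# - ⟨ x , y ⟩)))

  hellingerKernel : ℝ → ∀ {D} → Kernel D
  hellingerKernel α x y = exp (- (α * ‖ √ᵛ x ∸ᵛ √ᵛ y ‖ ^ 2))

  ------------------------------------------------------------------------
  -- Signings and coresets

  sumOver : ∀ {n} → Subset n → (Fin n → ℝ) → ℝ
  sumOver {n} S f = ∑[ i < n ] (if lookup S i then f i else 0#)

  -- Every finite family in X has a signing with sup_{y ∈ X} |∑ᵢ σᵢ K(xᵢ,y)| ≤ b.
  SigningBound : ∀ {D} → (ℝ^ D → Set) → Kernel D → ℝ → Set
  SigningBound {D} X K b =
    ∀ n (x : Fin n → ℝ^ D) → (∀ i → X (x i)) →
    ∃ λ (σ : Fin n → Sign) →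
      ∀ y → X y → ∣ ∑[ i < n ] (fromSign (σ i) * K (x i) y) ∣ ≤ b

  -- Every nonempty finite family in X has, for every ε ∈ (0,1], an ε-coreset
  -- of at most c / ε points.
  CoresetBound : ∀ {D} → (ℝ^ D → Set) → Kernel D → ℝ → Set
  CoresetBound {D} X K c =
    ∀ n → .{{NonZero n}} → (x : Fin n → ℝ^ D) → (∀ i → X (x i)) →
    ∀ ε → 0# < ε → ε ≤ 1# →
    ∃ λ (S : Subset n) →
      Nonempty S × fromℕ (card S) ≤ c / ε ×
      (∀ y → X y →
        ∣ sumOver S (λ i → K (x i) y) / fromℕ (card S)
          - (∑[ i < n ] K (x i) y) / fromℕ n ∣ ≤ ε)

  ------------------------------------------------------------------------
  -- Tai's constant

  -- g : Vec ℤ D stands for the point 2g of (2ℤ)^D.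
  centre : ∀ {D} → Vec ℤ D → ℝ^ D
  centre g j = fromℕ 2 * fromℤ (lookup g j)

  -- Half-open, so that the cells partition ℝ^D.
  Cell : ∀ {D} → Vec ℤ D → ℝ^ D → Set
  Cell g x = ∀ j → centre g j - 1# ≤ x j × x j < centre g j + 1#

  cellPart : ∀ {D n} → (Fin n → ℝ^ D) → Vec ℤ D → Subset n
  cellPart p g = tabulate (λ i → does (em {Cell g (p i)}))

  cellEnvelope : ∀ {D} → ℝ → Vec ℤ D → ℝ^ D → ℝ
  cellEnvelope C g x = C * exp (- (‖ x ∸ᵛ centre g ‖ ^ 2 / fromℕ 3))

  -- Tai's theorem in dimension D, packaged with the constants it yields: C is
  -- C_D and fT is f_T(D).  A finite set P is an injective family p; a signing
  -- of Q_g is a signing of all of P of which only the values on Q_g matter.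
  -- The series ∑_g has nonnegative terms, so fT bounds it exactly when it
  -- bounds its sums over finite sets of cells.
  record TaiConstant (D : ℕ) : Set where
    field
      C           : ℝ
      cellSigning : ∀ n (p : Fin n → ℝ^ D) → Injective _≡_ _≋_ p → ∀ g →
                    ∃ λ (σ : Fin n → Sign) →
                      (∀ x → ∣ sumOver (cellPart p g) (λ i → fromSign (σ i) * T x (p i)) ∣
                               ≤ cellEnvelope C g x) ×
                      ∣ sumOver (cellPart p g) (λ i → fromSign (σ i)) ∣ ≤ 1#
      fT          : ℝ
      cellSum     : ∀ x m (g : Fin m → Vec ℤ D) → Injective _≡_ _≡_ g →
                    ∑[ k < m ] cellEnvelope C (g k) x ≤ fT

{-# OPTIONS --safe #-}
module Submission where

-- After scaling, both kernels are Tai's kernel T: on the sphere α(1 − ⟨x,y⟩) = ‖βx − βy‖²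
-- with β² = α/2, and for the Hellinger kernel x is replaced by √α √x.  Equal points are
-- signed oppositely in pairs; the remaining distinct points are signed cell by cell, and
-- the negation of a whole cell is free, so the signing can also be balanced, |∑ σᵢ| ≤ 1.
-- The larger half of such a signing changes the average by at most 2 f_T / n.  Halving as
-- long as n ε exceeds a constant gives the coreset, the errors summing geometrically.

open import Defs
open import Level using (0ℓ)
open import Algebra.Solver.Ring.AlmostCommutativeRing
  using (fromCommutativeRing; _-Raw-AlmostCommutative⟶_)
open import Axiom.ExcludedMiddle using (ExcludedMiddle)
open import Data.Bool.Base using (Bool; true; false; if_then_else_)
open import Data.Empty using (⊥-elim)
open import Data.Fin.Base using (Fin; zero; suc; toℕ; punchIn; punchOut)
open import Data.Fin.Subset using (Subset; Nonempty; ⊤) renaming (∣_∣ to card)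
import Data.Fin.Properties as Fin
import Data.Fin.Subset.Properties as Subset
open import Data.Integer.Base as ℤ using (ℤ; +_; -[1+_]; _⊖_)
import Data.Integer.Properties as ℤ
open import Data.Maybe.Base using (Maybe; just; nothing)
open import Data.Nat.Base as ℕ using (ℕ; zero; suc)
import Data.Nat.Induction as ℕ
import Data.Nat.Properties as ℕ
open import Data.Product.Base using (∃; _×_; _,_; proj₁; proj₂)
open import Data.Sign.Base as Sign using (Sign)
open import Data.Sum.Base using (_⊎_; inj₁; inj₂)
open import Data.Vec.Base as Vec using (Vec; []; _∷_; here; there; lookup; tabulate)
open import Data.Vec.Functional using (insertAt; removeAt)
open import Data.Vec.Functional.Properties using (insertAt-lookup; insertAt-punchIn)
import Data.Vec.Properties as Vec
open import Function.Base using (case_of_)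
open import Function.Definitions using (Injective)
open import Relation.Binary.Bundles using (Poset)
open import Relation.Binary.PropositionalEquality.Core as ≡ using (_≡_; _≢_)
open import Relation.Binary.Structures using (IsTotalOrder)
open import Relation.Nullary.Decidable.Core using (yes; no; does)
open import Relation.Nullary.Negation.Core using (¬_; contradiction)
import Algebra.Properties.Ring
import Algebra.Properties.AbelianGroup
import Algebra.Properties.Semiring.Exp
import Algebra.Properties.Semiring.Mult
import Algebra.Properties.Semiring.Mult.TCOptimised
import Algebra.Properties.Semiring.Sum
import Algebra.Solver.Ring
import Relation.Binary.Reasoning.PartialOrder

-- Balance is what makes a signing usable for halving. The kept half S is averaged with weight
-- 1/|S|; when |∑ σᵢ| ≤ 1 its size is within 1/2 of n/2, and replacing n/2 by |S| costs no more than
-- the bound on the signed sum. This replacement needs a bound on single kernel values, for which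
-- `fT` serves again. The geometric sum of the errors is never written out. With B = 2 `fT`, halving
-- n points costs at most B / n, and the recursion carries the inequality n E + 2B ≤ n ε for the
-- error E made from n points downwards. For n ≥ 3 the number of points shrinks by a factor of at
-- least 3/2, and 2B is the least t with 3t/2 ≥ t + B, so the slack reproduces itself from each
-- level to the one above. Uniformity in α is automatic: α occurs only in the map from the domain
-- into Euclidean space, while `fT` depends on the dimension alone. Inverses, roots and limits are
-- witnesses picked by `em`, so each needs a congruence for `_≈_`, obtained from uniqueness.

module Development (em : ExcludedMiddle 0ℓ) (reals : CompleteOrderedField) where

  open Analysis em reals
  open IsTotalOrder isTotalOrder
    using (antisym; isPartialOrder)
    renaming (refl to ≤-refl; trans to ≤-trans; reflexive to ≤-reflexive)
  open Algebra.Properties.Ring ring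
    using (-‿distribˡ-*; -‿distribʳ-*; -0#≈0#; -‿involutive)
  open Algebra.Properties.AbelianGroup +-abelianGroup using (⁻¹-∙-comm)
  open Algebra.Properties.Semiring.Mult semiring using (×-homo-+; ×1-homo-*)
  open Algebra.Properties.Semiring.Mult.TCOptimised semiring using (×ᵤ≈×)
    renaming (_×_ to _×′_)
  open Algebra.Properties.Semiring.Exp semiring using (^-congˡ)
  open Algebra.Properties.Semiring.Sum semiring
    using (sum-cong-≋; sum-remove; ∑-distrib-+; ∑-comm; *-distribˡ-sum; sum-replicate-zero)

  poset : Poset 0ℓ 0ℓ 0ℓ
  poset = record { isPartialOrder = isPartialOrder }

  open Relation.Binary.Reasoning.PartialOrder poset

  -- Integer coefficients for the ring solver

  fromℤ-⊖ : ∀ m n → fromℤ (m ⊖ n) ≈ fromℕ m - fromℕ n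
  fromℤ-⊖ zero    zero    = sym (-‿inverseʳ 0#)
  fromℤ-⊖ zero    (suc n) = sym (+-identityˡ _)
  fromℤ-⊖ (suc m) zero    = sym (trans (+-congˡ -0#≈0#) (+-identityʳ _))
  fromℤ-⊖ (suc m) (suc n) = begin-equality
    fromℤ (suc m ⊖ suc n)              ≡⟨ ≡.cong fromℤ (ℤ.[1+m]⊖[1+n]≡m⊖n m n) ⟩
    fromℤ (m ⊖ n)                      ≈⟨ fromℤ-⊖ m n ⟩
    fromℕ m - fromℕ n                  ≈⟨ +-congʳ (+-identityˡ _) ⟨
    0# + fromℕ m - fromℕ n             ≈⟨ +-congʳ (+-congʳ (-‿inverseʳ 1#)) ⟨
    1# - 1# + fromℕ m - fromℕ n        ≈⟨ +-congʳ (+-assoc _ _ _) ⟩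
    1# + (- 1# + fromℕ m) - fromℕ n    ≈⟨ +-congʳ (+-congˡ (+-comm _ _)) ⟩
    1# + (fromℕ m - 1#) - fromℕ n      ≈⟨ +-congʳ (+-assoc _ _ _) ⟨
    fromℕ (suc m) - 1# - fromℕ n       ≈⟨ +-assoc _ _ _ ⟩
    fromℕ (suc m) + (- 1# - fromℕ n)   ≈⟨ +-congˡ (⁻¹-∙-comm _ _) ⟩
    fromℕ (suc m) - fromℕ (suc n)      ∎

  fromℤ-+ : ∀ i j → fromℤ (i ℤ.+ j) ≈ fromℤ i + fromℤ j
  fromℤ-+ (+ m)    (+ n)    = ×-homo-+ 1# m n
  fromℤ-+ (+ m)    -[1+ n ] = fromℤ-⊖ m (suc n)
  fromℤ-+ -[1+ m ] (+ n)    = trans (fromℤ-⊖ n (suc m)) (+-comm _ _)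
  fromℤ-+ -[1+ m ] -[1+ n ] = begin-equality
    - fromℕ (suc (suc (m ℕ.+ n)))      ≡⟨ ≡.cong (λ k → - fromℕ (suc k)) (ℕ.+-suc m n) ⟨
    - fromℕ (suc m ℕ.+ suc n)          ≈⟨ -‿cong (×-homo-+ 1# (suc m) (suc n)) ⟩
    - (fromℕ (suc m) + fromℕ (suc n))  ≈⟨ ⁻¹-∙-comm _ _ ⟨
    - fromℕ (suc m) - fromℕ (suc n)    ∎

  fromℤ-neg : ∀ i → fromℤ (ℤ.- i) ≈ - fromℤ i
  fromℤ-neg (+ zero)  = sym -0#≈0#
  fromℤ-neg (+ suc n) = refl
  fromℤ-neg -[1+ n ]  = sym (-‿involutive _)

  fromℤ-+* : ∀ m j → fromℤ (+ m ℤ.* j) ≈ fromℕ m * fromℤ j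
  fromℤ-+* m (+ n)    = trans (reflexive (≡.cong fromℤ (≡.sym (ℤ.pos-* m n)))) (×1-homo-* m n)
  fromℤ-+* m -[1+ n ] = begin-equality
    fromℤ (+ m ℤ.* -[1+ n ])         ≡⟨ ≡.cong fromℤ (ℤ.neg-distribʳ-* (+ m) (+ suc n)) ⟨
    fromℤ (ℤ.- (+ m ℤ.* + suc n))    ≈⟨ fromℤ-neg (+ m ℤ.* + suc n) ⟩
    - fromℤ (+ m ℤ.* + suc n)        ≈⟨ -‿cong (fromℤ-+* m (+ suc n)) ⟩
    - (fromℕ m * fromℕ (suc n))      ≈⟨ -‿distribʳ-* _ _ ⟩
    fromℕ m * - fromℕ (suc n)        ∎

  fromℤ-* : ∀ i j → fromℤ (i ℤ.* j) ≈ fromℤ i * fromℤ j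
  fromℤ-* (+ m)    j = fromℤ-+* m j
  fromℤ-* -[1+ m ] j = begin-equality
    fromℤ (-[1+ m ] ℤ.* j)           ≡⟨ ≡.cong fromℤ (ℤ.neg-distribˡ-* (+ suc m) j) ⟨
    fromℤ (ℤ.- (+ suc m ℤ.* j))      ≈⟨ fromℤ-neg (+ suc m ℤ.* j) ⟩
    - fromℤ (+ suc m ℤ.* j)          ≈⟨ -‿cong (fromℤ-+* (suc m) j) ⟩
    - (fromℕ (suc m) * fromℤ j)      ≈⟨ -‿distribˡ-* _ _ ⟩
    - fromℕ (suc m) * fromℤ j        ∎

  -- Unlike fromℤ, this sends 0 and 1 definitionally to 0# and 1#, so that solver
  -- constants match the goals.
  coefficient : ℤ → ℝ
  coefficient (+ n)    = n ×′ 1#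
  coefficient -[1+ n ] = - (suc n ×′ 1#)

  coefficient≈fromℤ : ∀ i → coefficient i ≈ fromℤ i
  coefficient≈fromℤ (+ n)    = sym (×ᵤ≈× n 1#)
  coefficient≈fromℤ -[1+ n ] = -‿cong (sym (×ᵤ≈× (suc n) 1#))

  coefficientMorphism : ℤ.+-*-rawRing -Raw-AlmostCommutative⟶ fromCommutativeRing commutativeRing
  coefficientMorphism = record
    { ⟦_⟧    = coefficient
    ; +-homo = λ i j → trans (coefficient≈fromℤ (i ℤ.+ j)) (trans (fromℤ-+ i j)
        (sym (+-cong (coefficient≈fromℤ i) (coefficient≈fromℤ j))))
    ; *-homo = λ i j → trans (coefficient≈fromℤ (i ℤ.* j)) (trans (fromℤ-* i j)
        (sym (*-cong (coefficient≈fromℤ i) (coefficient≈fromℤ j))))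
    ; -‿homo = λ i → trans (coefficient≈fromℤ (ℤ.- i)) (trans (fromℤ-neg i)
        (sym (-‿cong (coefficient≈fromℤ i))))
    ; 0-homo = refl
    ; 1-homo = refl
    }

  coefficient≟ : ∀ i j → Maybe (coefficient i ≈ coefficient j)
  coefficient≟ i j with i ℤ.≟ j
  ... | yes i≡j = just (reflexive (≡.cong coefficient i≡j))
  ... | no  _   = nothing

  open Algebra.Solver.Ring ℤ.+-*-rawRing (fromCommutativeRing commutativeRing)
    coefficientMorphism coefficient≟
    using (solve; _:=_; _:+_; _:*_; _:-_; :-_; con; Polynomial)

  :0 :1 : ∀ {n} → Polynomial n
  :0 = con (+ 0)
  :1 = con (+ 1)

  -- Order

  gap : ∀ {x y} → x ≤ y → 0# ≤ y - x
  gap {x} x≤y = ≤-trans (≤-reflexive (sym (-‿inverseʳ x))) (+-monoˡ-≤ (- x) x≤y)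

  -- The standard way to prove an inequality below: `e` is assembled from quantities known to be
  -- nonnegative, and the ring solver checks that it is the difference.
  ≤-fromGap : ∀ {x y e} → 0# ≤ e → y - x ≈ e → x ≤ y
  ≤-fromGap {x} {y} {e} 0≤e y-x≈e = begin
    x          ≈⟨ +-identityˡ x ⟨
    0# + x     ≤⟨ +-monoˡ-≤ x 0≤e ⟩
    e + x      ≈⟨ +-congʳ y-x≈e ⟨
    y - x + x  ≈⟨ solve 2 (λ x y → y :- x :+ x := y) refl x y ⟩
    y          ∎

  +-nonNeg : ∀ {x y} → 0# ≤ x → 0# ≤ y → 0# ≤ x + y
  +-nonNeg {x} {y} 0≤x 0≤y = ≤-trans 0≤y
    (≤-fromGap 0≤x (solve 2 (λ x y → x :+ y :- y := x) refl x y))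

  +-mono-≤ : ∀ {w x y z} → w ≤ x → y ≤ z → w + y ≤ x + z
  +-mono-≤ {w} {x} {y} {z} w≤x y≤z = ≤-fromGap (+-nonNeg (gap w≤x) (gap y≤z))
    (solve 4 (λ w x y z → x :+ z :- (w :+ y) := (x :- w) :+ (z :- y)) refl w x y z)

  *-monoˡ-≤ : ∀ {z x y} → 0# ≤ z → x ≤ y → z * x ≤ z * y
  *-monoˡ-≤ {z} {x} {y} 0≤z x≤y = ≤-fromGap (*-nonNeg 0≤z (gap x≤y))
    (solve 3 (λ z x y → z :* y :- z :* x := z :* (y :- x)) refl z x y)

  *-monoʳ-≤ : ∀ {z x y} → 0# ≤ z → x ≤ y → x * z ≤ y * z
  *-monoʳ-≤ {z} {x} {y} 0≤z x≤y = ≤-fromGap (*-nonNeg 0≤z (gap x≤y))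
    (solve 3 (λ z x y → y :* z :- x :* z := z :* (y :- x)) refl z x y)

  neg-nonNeg : ∀ {x} → x ≤ 0# → 0# ≤ - x
  neg-nonNeg {x} x≤0 = ≤-trans (gap x≤0) (≤-reflexive (+-identityˡ _))

  square-nonNeg : ∀ x → 0# ≤ x * x
  square-nonNeg x with total 0# x
  ... | inj₁ 0≤x = *-nonNeg 0≤x 0≤x
  ... | inj₂ x≤0 = ≤-trans (*-nonNeg (neg-nonNeg x≤0) (neg-nonNeg x≤0))
    (≤-reflexive (solve 1 (λ x → :- x :* :- x := x :* x) refl x))

  0≤1 : 0# ≤ 1#
  0≤1 = ≤-trans (square-nonNeg 1#) (≤-reflexive (*-identityˡ 1#))

  0<1 : 0# < 1#
  0<1 = 0≤1 , λ 0≈1 → 1≉0 (sym 0≈1)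

  <⇒≱ : ∀ {x y} → x < y → ¬ (y ≤ x)
  <⇒≱ (x≤y , x≉y) y≤x = x≉y (antisym x≤y y≤x)

  ≤⊎> : ∀ x y → x ≤ y ⊎ y < x
  ≤⊎> x y with em {x ≤ y} | total x y
  ... | yes x≤y | _        = inj₁ x≤y
  ... | no  _   | inj₁ x≤y = inj₁ x≤y
  ... | no  x≰y | inj₂ y≤x = inj₂ (y≤x , λ y≈x → x≰y (≤-reflexive (sym y≈x)))

  ≰⇒> : ∀ {x y} → ¬ (x ≤ y) → y < x
  ≰⇒> {x} {y} x≰y with ≤⊎> x y
  ... | inj₁ x≤y = contradiction x≤y x≰y
  ... | inj₂ y<x = y<x

  ≮⇒≥ : ∀ {x y} → ¬ (x < y) → y ≤ x
  ≮⇒≥ {x} {y} x≮y with ≤⊎> y x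
  ... | inj₁ y≤x = y≤x
  ... | inj₂ x<y = contradiction x<y x≮y

  <-≤-trans : ∀ {x y z} → x < y → y ≤ z → x < z
  <-≤-trans x<y y≤z = ≤-trans (proj₁ x<y) y≤z ,
    λ x≈z → <⇒≱ x<y (≤-trans y≤z (≤-reflexive (sym x≈z)))

  ≤-<-trans : ∀ {x y z} → x ≤ y → y < z → x < z
  ≤-<-trans x≤y y<z = ≤-trans x≤y (proj₁ y<z) ,
    λ x≈z → <⇒≱ y<z (≤-trans (≤-reflexive (sym x≈z)) x≤y)

  0<gap : ∀ {x y} → x < y → 0# < y - x
  0<gap {x} {y} x<y = ≰⇒> λ y-x≤0 → <⇒≱ x<y
    (≤-fromGap (neg-nonNeg y-x≤0) (solve 2 (λ x y → x :- y := :- (y :- x)) refl x y))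

  -- The order axioms give only nonnegativity; strictness comes from the field, where multiplying by
  -- the inverse of `x` shows that a zero product forces `y ≈ 0#`.
  *-pos : ∀ {x y} → 0# < x → 0# < y → 0# < x * y
  *-pos {x} {y} (0≤x , 0≉x) (0≤y , 0≉y) = *-nonNeg 0≤x 0≤y , λ 0≈xy →
    let (z , xz≈1) = inverse x (λ x≈0 → 0≉x (sym x≈0)) in
    0≉y (begin-equality
      0#           ≈⟨ zeroʳ z ⟨
      z * 0#       ≈⟨ *-congˡ 0≈xy ⟩
      z * (x * y)  ≈⟨ solve 3 (λ x y z → z :* (x :* y) := x :* z :* y) refl x y z ⟩
      x * z * y    ≈⟨ *-congʳ xz≈1 ⟩
      1# * y       ≈⟨ *-identityˡ y ⟩
      y            ∎)

  +-pos : ∀ {x y} → 0# < x → 0# ≤ y → 0# < x + y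
  +-pos {x} {y} 0<x 0≤y = <-≤-trans 0<x
    (≤-fromGap 0≤y (solve 2 (λ x y → x :+ y :- x := y) refl x y))

  *-cancelˡ-≤ : ∀ {z x y} → 0# < z → z * x ≤ z * y → x ≤ y
  *-cancelˡ-≤ {z} {x} {y} 0<z zx≤zy = ≮⇒≥ λ y<x → <⇒≱ (*-pos 0<z (0<gap y<x))
    (≤-fromGap (gap zx≤zy)
      (solve 3 (λ z x y → :0 :- z :* (x :- y) := z :* y :- z :* x) refl z x y))

  -- Absolute value

  ∣∣-elim : ∀ {x b} → ∣ x ∣ ≤ b → x ≤ b × - x ≤ b
  ∣∣-elim {x} ∣x∣≤b with total 0# x
  ... | inj₁ 0≤x = ∣x∣≤b , ≤-trans
    (≤-fromGap (+-nonNeg 0≤x 0≤x) (solve 1 (λ x → x :- :- x := x :+ x) refl x)) ∣x∣≤b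
  ... | inj₂ x≤0 = ≤-trans
    (≤-fromGap (+-nonNeg (neg-nonNeg x≤0) (neg-nonNeg x≤0))
      (solve 1 (λ x → :- x :- x := :- x :+ :- x) refl x)) ∣x∣≤b , ∣x∣≤b

  ∣∣-intro : ∀ {x b} → x ≤ b → - x ≤ b → ∣ x ∣ ≤ b
  ∣∣-intro {x} x≤b -x≤b with total 0# x
  ... | inj₁ _ = x≤b
  ... | inj₂ _ = -x≤b

  -- `∣_∣` branches on `total`, which may answer differently for equivalent arguments near zero, so
  -- the transport goes through the two one-sided bounds.
  ∣∣-resp : ∀ {x y b} → x ≈ y → ∣ x ∣ ≤ b → ∣ y ∣ ≤ b
  ∣∣-resp x≈y ∣x∣≤b = let (x≤b , -x≤b) = ∣∣-elim ∣x∣≤b in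
    ∣∣-intro (≤-trans (≤-reflexive (sym x≈y)) x≤b)
             (≤-trans (≤-reflexive (-‿cong (sym x≈y))) -x≤b)

  ∣∣-cong : ∀ {x y} → x ≈ y → ∣ x ∣ ≈ ∣ y ∣
  ∣∣-cong x≈y = antisym (∣∣-resp (sym x≈y) ≤-refl) (∣∣-resp x≈y ≤-refl)

  ∣0∣≤0 : ∣ 0# ∣ ≤ 0#
  ∣0∣≤0 = ∣∣-intro ≤-refl (≤-reflexive -0#≈0#)

  ∣∣-neg : ∀ {x b} → ∣ x ∣ ≤ b → ∣ - x ∣ ≤ b
  ∣∣-neg ∣x∣≤b = let (x≤b , -x≤b) = ∣∣-elim ∣x∣≤b in
    ∣∣-intro -x≤b (≤-trans (≤-reflexive (-‿involutive _)) x≤b)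

  ∣∣-+ : ∀ {x y b c} → ∣ x ∣ ≤ b → ∣ y ∣ ≤ c → ∣ x + y ∣ ≤ b + c
  ∣∣-+ {x} {y} ∣x∣≤b ∣y∣≤c =
    let (x≤b , -x≤b) = ∣∣-elim ∣x∣≤b
        (y≤c , -y≤c) = ∣∣-elim ∣y∣≤c
    in ∣∣-intro (+-mono-≤ x≤b y≤c)
         (≤-trans (≤-reflexive (sym (⁻¹-∙-comm x y))) (+-mono-≤ -x≤b -y≤c))

  ∣∣-sum : ∀ {n} (f b : Fin n → ℝ) → (∀ i → ∣ f i ∣ ≤ b i) → ∣ sum f ∣ ≤ sum b
  ∣∣-sum {zero}  f b f≤b = ∣0∣≤0
  ∣∣-sum {suc n} f b f≤b = ∣∣-+ (f≤b zero) (∣∣-sum (λ i → f (suc i)) (λ i → b (suc i)) (λ i → f≤b (suc i)))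

  ∣∣-sign : ∀ s {x b} → ∣ x ∣ ≤ b → ∣ fromSign s * x ∣ ≤ b
  ∣∣-sign Sign.+ {x} ∣x∣≤b = ∣∣-resp (sym (*-identityˡ x)) ∣x∣≤b
  ∣∣-sign Sign.- {x} ∣x∣≤b = ∣∣-resp (solve 1 (λ x → :- x := :- :1 :* x) refl x) (∣∣-neg ∣x∣≤b)

  -- Unique choice and limits

  the-satisfies : (P : ℝ → Set) → ∃ P → P (the P)
  the-satisfies P ∃P with em {∃ P}
  ... | yes (_ , Px) = Px
  ... | no  ∄P       = contradiction ∃P ∄P

  -- The witnesses that `em` supplies for `P` and `Q` are unrelated; only uniqueness identifies
  -- them. If neither exists, both sides are the same junk value.
  the-cong : {P Q : ℝ → Set} → (∀ {x} → P x → Q x) → (∀ {x} → Q x → P x) →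
             (∀ {x y} → P x → P y → x ≈ y) → the P ≈ the Q
  the-cong {P} {Q} P⇒Q Q⇒P unique with em {∃ P} | em {∃ Q}
  ... | yes (x , Px) | yes (y , Qy) = unique Px (Q⇒P Qy)
  ... | yes (x , Px) | no  ∄Q       = contradiction (x , P⇒Q Px) ∄Q
  ... | no  ∄P       | yes (y , Qy) = contradiction (y , Q⇒P Qy) ∄P
  ... | no  _        | no  _        = refl

  ⁻¹-cong : ∀ {x y} → x ≈ y → x ⁻¹ ≈ y ⁻¹
  ⁻¹-cong {x} x≈y = the-cong (trans (*-congʳ (sym x≈y))) (trans (*-congʳ x≈y))
    λ {u} {v} xu≈1 xv≈1 → begin-equality
      u            ≈⟨ *-identityʳ u ⟨
      u * 1#       ≈⟨ *-congˡ xv≈1 ⟨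
      u * (x * v)  ≈⟨ solve 3 (λ x u v → u :* (x :* v) := v :* (x :* u)) refl x u v ⟩
      v * (x * u)  ≈⟨ *-congˡ xu≈1 ⟩
      v * 1#       ≈⟨ *-identityʳ v ⟩
      v            ∎

  /-cong : ∀ {x y u v} → x ≈ y → u ≈ v → x / u ≈ y / v
  /-cong x≈y u≈v = *-cong x≈y (⁻¹-cong u≈v)

  *-inverse : ∀ {z} → 0# < z → z * z ⁻¹ ≈ 1#
  *-inverse {z} (_ , 0≉z) = the-satisfies _ (inverse z λ z≈0 → 0≉z (sym z≈0))

  *-/ : ∀ x {z} → 0# < z → z * (x / z) ≈ x
  *-/ x {z} 0<z = begin-equality
    z * (x * z ⁻¹)  ≈⟨ solve 3 (λ x z w → z :* (x :* w) := x :* (z :* w)) refl x z (z ⁻¹) ⟩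
    x * (z * z ⁻¹)  ≈⟨ *-congˡ (*-inverse 0<z) ⟩
    x * 1#          ≈⟨ *-identityʳ x ⟩
    x               ∎

  /-pos : ∀ {x z} → 0# < x → 0# < z → 0# < x / z
  /-pos {x} {z} 0<x 0<z = ≰⇒> λ x/z≤0 → <⇒≱ 0<x (begin
    x            ≈⟨ *-/ x 0<z ⟨
    z * (x / z)  ≤⟨ *-monoˡ-≤ (proj₁ 0<z) x/z≤0 ⟩
    z * 0#       ≈⟨ zeroʳ z ⟩
    0#           ∎)

  0<2 : 0# < 1# + 1#
  0<2 = +-pos 0<1 0≤1

  -- For positive `d`, the choice ε = d/4 would give d ≤ d/2.
  ≤0-fromSmall : ∀ {d} → (∀ ε → 0# < ε → d ≤ ε + ε) → d ≤ 0#
  ≤0-fromSmall {d} small = ≮⇒≥ λ 0<d →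
    let h   = d / (1# + 1#) / (1# + 1#)
        0<h = /-pos (/-pos 0<d 0<2) 0<2
    in <⇒≱ (*-pos 0<2 0<h) (≤-fromGap (gap (small h 0<h)) (begin-equality
      0# - (1# + 1#) * h                       ≈⟨ solve 1 (λ h → :0 :- (:1 :+ :1) :* h := h :+ h :- (:1 :+ :1) :* ((:1 :+ :1) :* h)) refl h ⟩
      h + h - (1# + 1#) * ((1# + 1#) * h)      ≈⟨ +-congˡ (-‿cong (trans (*-congˡ (*-/ _ 0<2)) (*-/ d 0<2))) ⟩
      h + h - d                                ∎))

  ConvergesTo-≤ : ∀ {s l m} → ConvergesTo s l → ConvergesTo s m → l - m ≤ 0#
  ConvergesTo-≤ {s} {l} {m} s→l s→m = ≤0-fromSmall λ ε 0<ε →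
    let (M , nearL) = s→l ε 0<ε
        (N , nearM) = s→m ε 0<ε
        n           = M ℕ.⊔ N
        (_ , l-s≤ε) = ∣∣-elim (proj₁ (nearL n (ℕ.m≤m⊔n M N)))
        (s-m≤ε , _) = ∣∣-elim (proj₁ (nearM n (ℕ.m≤n⊔m M N)))
    in begin
      l - m                    ≈⟨ solve 3 (λ l m s → l :- m := :- (s :- l) :+ (s :- m)) refl l m (s n) ⟩
      - (s n - l) + (s n - m)  ≤⟨ +-mono-≤ l-s≤ε s-m≤ε ⟩
      ε + ε                    ∎

  ConvergesTo-unique : ∀ {s l m} → ConvergesTo s l → ConvergesTo s m → l ≈ m
  ConvergesTo-unique {s} {l} {m} s→l s→m = antisym (flat (ConvergesTo-≤ s→l s→m)) (flat (ConvergesTo-≤ s→m s→l))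
    where
    flat : ∀ {x y} → x - y ≤ 0# → x ≤ y
    flat {x} {y} x-y≤0 = ≤-fromGap (neg-nonNeg x-y≤0) (solve 2 (λ x y → y :- x := :- (x :- y)) refl x y)

  ConvergesTo-resp : ∀ {s t l} → (∀ n → s n ≈ t n) → ConvergesTo s l → ConvergesTo t l
  ConvergesTo-resp {s} {t} {l} s≈t s→l ε 0<ε =
    let (N , near) = s→l ε 0<ε in
    N , λ n N≤n → ≤-<-trans (≤-reflexive (∣∣-cong (+-congʳ (sym (s≈t n))))) (near n N≤n)

  -- Pointwise equivalent sequences have the same limits, so both sides take the one limit or both
  -- fall back on `0#`.
  limit-cong : ∀ {s t} → (∀ n → s n ≈ t n) → limit s ≈ limit t
  limit-cong s≈t = the-cong (ConvergesTo-resp s≈t) (ConvergesTo-resp (λ n → sym (s≈t n))) ConvergesTo-unique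

  exp-cong : ∀ {x y} → x ≈ y → exp x ≈ exp y
  exp-cong x≈y = limit-cong λ n → sum-cong-≋ {n} λ k → *-congʳ (^-congˡ (toℕ k) x≈y)

  -- Square roots

  square-cancel-≤ : ∀ {x y} → 0# ≤ x → 0# ≤ y → x * x ≤ y * y → x ≤ y
  square-cancel-≤ {x} {y} 0≤x 0≤y xx≤yy = ≮⇒≥ λ y<x →
    <⇒≱ (*-pos (0<gap y<x) (<-≤-trans (0<gap y<x)
          (≤-fromGap (+-nonNeg 0≤y 0≤y) (solve 2 (λ x y → x :+ y :- (x :- y) := y :+ y) refl x y))))
      (≤-fromGap (gap xx≤yy)
        (solve 2 (λ x y → :0 :- (x :- y) :* (x :+ y) := y :* y :- x :* x) refl x y))

  -- The root is the supremum s of all x ≥ 0 with x² ≤ a. If s² missed a on either side, moving s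
  -- slightly towards the root would contradict its being the least upper bound.
  squareRoot : ∀ a → 0# ≤ a → ∃ λ s → 0# ≤ s × s * s ≈ a
  squareRoot a 0≤a = s , 0≤s , antisym ss≤a a≤ss
    where
    Below : ℝ → Set
    Below x = 0# ≤ x × x * x ≤ a

    bound : UpperBound Below (1# + a)
    bound x (0≤x , xx≤a) with total x 1#
    ... | inj₁ x≤1 = ≤-trans x≤1
      (≤-fromGap 0≤a (solve 1 (λ a → :1 :+ a :- :1 := a) refl a))
    ... | inj₂ 1≤x = begin
      x       ≈⟨ *-identityʳ x ⟨
      x * 1#  ≤⟨ *-monoˡ-≤ 0≤x 1≤x ⟩
      x * x   ≤⟨ xx≤a ⟩
      a       ≤⟨ ≤-fromGap 0≤1 (solve 1 (λ a → :1 :+ a :- a := :1) refl a) ⟩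
      1# + a  ∎

    0∈Below : Below 0#
    0∈Below = ≤-refl , ≤-trans (≤-reflexive (zeroˡ 0#)) 0≤a

    sup = supremum Below (0# , 0∈Below) (1# + a , bound)
    s   = proj₁ sup

    0≤s : 0# ≤ s
    0≤s = proj₁ (proj₂ sup) 0# 0∈Below

    ss≤a : s * s ≤ a
    ss≤a = ≮⇒≥ λ a<ss →
      let δ   = s * s - a
          0<δ = 0<gap a<ss
          0<s = ≰⇒> λ s≤0 → <⇒≱ a<ss (≤-trans (≤-reflexive
                  (trans (*-congʳ (antisym s≤0 0≤s)) (zeroˡ s))) 0≤a)
          -- A Newton step: for h = (s² - a) / 2s one has (s - h)² = a + h² ≥ a, so s - h would be a
          -- smaller upper bound.
          K   = s + s
          0<K = +-pos 0<s 0≤s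
          h   = δ / K
          Kh≈δ : K * h ≈ δ
          Kh≈δ = *-/ δ 0<K
          0<h = /-pos 0<δ 0<K
          0≤s-h : 0# ≤ s - h
          0≤s-h = *-cancelˡ-≤ 0<K (≤-fromGap (+-nonNeg (square-nonNeg s) 0≤a) (begin-equality
            K * (s - h) - K * 0#       ≈⟨ solve 2 (λ s h → (s :+ s) :* (s :- h) :- (s :+ s) :* :0 := s :* s :+ (s :* s :- (s :+ s) :* h)) refl s h ⟩
            s * s + (s * s - K * h)    ≈⟨ +-congˡ (+-congˡ (-‿cong Kh≈δ)) ⟩
            s * s + (s * s - δ)        ≈⟨ solve 2 (λ s a → s :* s :+ (s :* s :- (s :* s :- a)) := s :* s :+ a) refl s a ⟩
            s * s + a                  ∎))
          s-h-bound : UpperBound Below (s - h)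
          s-h-bound x (0≤x , xx≤a) = square-cancel-≤ 0≤x 0≤s-h (≤-trans xx≤a
            (≤-fromGap (square-nonNeg h) (begin-equality
              (s - h) * (s - h) - a          ≈⟨ solve 3 (λ s h a → (s :- h) :* (s :- h) :- a := s :* s :- a :- (s :+ s) :* h :+ h :* h) refl s h a ⟩
              δ - K * h + h * h              ≈⟨ +-congʳ (+-congˡ (-‿cong Kh≈δ)) ⟩
              δ - δ + h * h                  ≈⟨ solve 2 (λ δ h → δ :- δ :+ h :* h := h :* h) refl δ h ⟩
              h * h                          ∎)))
      in <⇒≱ 0<h (≤-fromGap (gap (proj₂ (proj₂ sup) (s - h) s-h-bound))
           (solve 2 (λ s h → :0 :- h := s :- h :- s) refl s h))

    a≤ss : a ≤ s * s
    a≤ss = ≮⇒≥ λ ss<a →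
      let δ   = a - s * s
          0<δ = 0<gap ss<a
          -- The summand δ forces h ≤ 1, so h² ≤ h; the summand 2s + 1 then keeps 2sh + h² below δ,
          -- and s + h still has square at most a.
          K   = δ + (s + s + 1#)
          0<K = +-pos 0<δ (+-nonNeg (+-nonNeg 0≤s 0≤s) 0≤1)
          h   = δ / K
          Kh≈δ : K * h ≈ δ
          Kh≈δ = *-/ δ 0<K
          0<h = /-pos 0<δ 0<K
          h≤1 : h ≤ 1#
          h≤1 = *-cancelˡ-≤ 0<K (≤-fromGap (+-nonNeg (+-nonNeg 0≤s 0≤s) 0≤1) (begin-equality
            K * 1# - K * h     ≈⟨ +-cong (*-identityʳ K) (-‿cong Kh≈δ) ⟩
            K - δ              ≈⟨ solve 2 (λ s δ → δ :+ (s :+ s :+ :1) :- δ := s :+ s :+ :1) refl s δ ⟩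
            s + s + 1#         ∎))
          s+h∈Below : Below (s + h)
          s+h∈Below = +-nonNeg 0≤s (proj₁ 0<h) ,
            ≤-fromGap (+-nonNeg (*-nonNeg (proj₁ 0<δ) (proj₁ 0<h)) (*-nonNeg (proj₁ 0<h) (gap h≤1)))
              (begin-equality
                a - (s + h) * (s + h)
                  ≈⟨ solve 4 (λ s h a δ → a :- (s :+ h) :* (s :+ h) := (a :- s :* s :- (δ :+ (s :+ s :+ :1)) :* h) :+ (δ :* h :+ h :* (:1 :- h))) refl s h a δ ⟩
                (δ - K * h) + (δ * h + h * (1# - h))
                  ≈⟨ +-congʳ (trans (+-congˡ (-‿cong Kh≈δ)) (-‿inverseʳ δ)) ⟩
                0# + (δ * h + h * (1# - h))
                  ≈⟨ +-identityˡ _ ⟩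
                δ * h + h * (1# - h)
                  ∎)
      in <⇒≱ 0<h (≤-fromGap (gap (proj₁ (proj₂ sup) (s + h) s+h∈Below))
           (solve 2 (λ s h → :0 :- h := s :- (s :+ h)) refl s h))

  √-satisfies : ∀ {x} → 0# ≤ x → 0# ≤ √ x × √ x * √ x ≈ x
  √-satisfies {x} 0≤x = the-satisfies _ (squareRoot x 0≤x)

  √-cong : ∀ {x y} → x ≈ y → √ x ≈ √ y
  √-cong x≈y = the-cong
    (λ (0≤r , rr≈x) → 0≤r , trans rr≈x x≈y)
    (λ (0≤r , rr≈y) → 0≤r , trans rr≈y (sym x≈y))
    (λ (0≤r , rr≈x) (0≤t , tt≈x) → antisym
      (square-cancel-≤ 0≤r 0≤t (≤-reflexive (trans rr≈x (sym tt≈x))))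
      (square-cancel-≤ 0≤t 0≤r (≤-reflexive (trans tt≈x (sym rr≈x)))))

  -- Integer parts

  -- Otherwise `r` bounds the naturals, and they have a supremum s. Since n + 1 ≤ s for every n,
  -- already s - 1 is an upper bound.
  archimedean : ∀ r → ∃ λ n → r ≤ fromℕ n
  archimedean r with em {∃ λ n → r ≤ fromℕ n}
  ... | yes found = found
  ... | no  none  = ⊥-elim (<⇒≱ 0<1 (≤-fromGap (gap s≤s-1)
          (solve 1 (λ s → :0 :- :1 := s :- :1 :- s) refl s)))
    where
    IsNatural : ℝ → Set
    IsNatural x = ∃ λ n → x ≈ fromℕ n

    bound : UpperBound IsNatural r
    bound x (n , x≈n) with ≤⊎> x r
    ... | inj₁ x≤r = x≤r
    ... | inj₂ r<x = contradiction (n , ≤-trans (proj₁ r<x) (≤-reflexive x≈n)) none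

    sup = supremum IsNatural (0# , 0 , refl) (r , bound)
    s   = proj₁ sup

    s≤s-1 : s ≤ s - 1#
    s≤s-1 = proj₂ (proj₂ sup) (s - 1#) λ x (n , x≈n) →
      ≤-fromGap (gap (proj₁ (proj₂ sup) (1# + x) (suc n , +-congˡ x≈n)))
        (solve 2 (λ s x → s :- :1 :- x := s :- (:1 :+ x)) refl s x)

  fromℕ-nonNeg : ∀ n → 0# ≤ fromℕ n
  fromℕ-nonNeg zero    = ≤-refl
  fromℕ-nonNeg (suc n) = +-nonNeg 0≤1 (fromℕ-nonNeg n)

  fromℕ-pos : ∀ n → 0 ℕ.< n → 0# < fromℕ n
  fromℕ-pos (suc n) _ = +-pos 0<1 (fromℕ-nonNeg n)

  fromℕ-mono : ∀ {m n} → m ℕ.≤ n → fromℕ m ≤ fromℕ n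
  fromℕ-mono {n = n} ℕ.z≤n       = fromℕ-nonNeg n
  fromℕ-mono         (ℕ.s≤s m≤n) = +-mono-≤ ≤-refl (fromℕ-mono m≤n)

  fromℤ-nonNeg : ∀ {i} → + 0 ℤ.≤ i → 0# ≤ fromℤ i
  fromℤ-nonNeg {+ n} _ = fromℕ-nonNeg n

  fromℤ-mono : ∀ {i j} → i ℤ.≤ j → fromℤ i ≤ fromℤ j
  fromℤ-mono {i} {j} i≤j = ≤-fromGap (fromℤ-nonNeg (ℤ.i≤j⇒0≤j-i i≤j))
    (sym (trans (fromℤ-+ j (ℤ.- i)) (+-congˡ (fromℤ-neg i))))

  0<fromℕ2 : 0# < fromℕ 2
  0<fromℕ2 = fromℕ-pos 2 (ℕ.s≤s ℕ.z≤n)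

  evenFloorℕ : ∀ n t → 0# ≤ t → t < fromℕ 2 * fromℕ n →
               ∃ λ j → fromℕ 2 * fromℕ j ≤ t × t < fromℕ 2 * fromℕ (suc j)
  evenFloorℕ zero    t 0≤t t<0 =
    contradiction 0≤t (<⇒≱ (<-≤-trans t<0 (≤-reflexive (zeroʳ _))))
  evenFloorℕ (suc n) t 0≤t t<2[1+n] with ≤⊎> (fromℕ 2 * fromℕ n) t
  ... | inj₁ 2n≤t = n , 2n≤t , t<2[1+n]
  ... | inj₂ t<2n = evenFloorℕ n t 0≤t t<2n

  fromℕ-two : fromℕ 2 ≈ 1# + 1#
  fromℕ-two = +-congˡ (+-identityʳ 1#)

  -- The quantity r + 1 is raised by an even natural 2N until it is nonnegative, its even floor 2j
  -- is found by search, and `j ⊖ N` undoes the shift.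
  nearestEven : ∀ r → ∃ λ z → fromℕ 2 * fromℤ z - 1# ≤ r × r < fromℕ 2 * fromℤ z + 1#
  nearestEven r = j ⊖ N ,
    ≤-fromGap (gap 2j≤t) (begin-equality
      r - (fromℕ 2 * fromℤ (j ⊖ N) - 1#)    ≈⟨ +-congˡ (-‿cong (+-congʳ (*-congˡ (fromℤ-⊖ j N)))) ⟩
      r - (fromℕ 2 * (fromℕ j - fromℕ N) - 1#)
        ≈⟨ solve 4 (λ r d j N → r :- (d :* (j :- N) :- :1) := r :+ :1 :+ d :* N :- d :* j) refl r (fromℕ 2) (fromℕ j) (fromℕ N) ⟩
      t - fromℕ 2 * fromℕ j                 ∎) ,
    ≰⇒> (λ r≥ → <⇒≱ t<2[1+j] (≤-fromGap (gap r≥) (begin-equality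
      t - fromℕ 2 * (1# + fromℕ j)
        ≈⟨ solve 4 (λ r d j N → r :+ :1 :+ d :* N :- d :* (:1 :+ j) := r :+ :1 :- d :- d :* (j :- N)) refl r (fromℕ 2) (fromℕ j) (fromℕ N) ⟩
      r + 1# - fromℕ 2 - fromℕ 2 * (fromℕ j - fromℕ N)
        ≈⟨ +-cong (+-congˡ (-‿cong fromℕ-two)) (-‿cong (*-congˡ (sym (fromℤ-⊖ j N)))) ⟩
      r + 1# - (1# + 1#) - fromℕ 2 * fromℤ (j ⊖ N)
        ≈⟨ solve 2 (λ r x → r :+ :1 :- (:1 :+ :1) :- x := r :- (x :+ :1)) refl r (fromℕ 2 * fromℤ (j ⊖ N)) ⟩
      r - (fromℕ 2 * fromℤ (j ⊖ N) + 1#)    ∎)))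
    where
    n≤2n : ∀ n → fromℕ n ≤ fromℕ 2 * fromℕ n
    n≤2n n = ≤-fromGap (fromℕ-nonNeg n) (trans (+-congʳ (*-congʳ fromℕ-two))
      (solve 1 (λ n → (:1 :+ :1) :* n :- n := n) refl (fromℕ n)))

    N = proj₁ (archimedean (- (r + 1#)))
    t = r + 1# + fromℕ 2 * fromℕ N

    0≤t : 0# ≤ t
    0≤t = ≤-trans (gap (≤-trans (proj₂ (archimedean (- (r + 1#)))) (n≤2n N)))
      (≤-reflexive (solve 2 (λ r x → x :- :- (r :+ :1) := r :+ :1 :+ x) refl r (fromℕ 2 * fromℕ N)))

    M = proj₁ (archimedean (1# + t))

    t<2M : t < fromℕ 2 * fromℕ M
    t<2M = <-≤-trans
      (≰⇒> λ 1+t≤t → <⇒≱ 0<1 (≤-fromGap (gap 1+t≤t) (solve 1 (λ t → :0 :- :1 := t :- (:1 :+ t)) refl t)))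
      (≤-trans (proj₂ (archimedean (1# + t))) (n≤2n M))

    floor = evenFloorℕ M t 0≤t t<2M
    j         = proj₁ floor
    2j≤t      = proj₁ (proj₂ floor)
    t<2[1+j]  = proj₂ (proj₂ floor)

  -- If j < i, then 2j + 1 ≤ 2i - 1, and the two half-open intervals are disjoint. Used in both
  -- directions it makes the cell of a point unique.
  nearestEven-≤ : ∀ {i j r} → fromℕ 2 * fromℤ i - 1# ≤ r → r < fromℕ 2 * fromℤ j + 1# → i ℤ.≤ j
  nearestEven-≤ {i} {j} {r} 2i-1≤r r<2j+1 = ℤ.≮⇒≥ λ j<i →
    <⇒≱ (≤-<-trans 2i-1≤r r<2j+1) (begin
      fromℕ 2 * fromℤ j + 1#
        ≈⟨ solve 2 (λ d j → d :* j :+ :1 := d :* (:1 :+ j) :- (d :- :1)) refl (fromℕ 2) (fromℤ j) ⟩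
      fromℕ 2 * (1# + fromℤ j) - (fromℕ 2 - 1#)
        ≈⟨ +-cong (*-congˡ (trans (+-congʳ (sym (+-identityʳ 1#))) (sym (fromℤ-+ (+ 1) j))))
             (-‿cong (trans (+-congʳ fromℕ-two) (solve 0 (:1 :+ :1 :- :1 := :1) refl))) ⟩
      fromℕ 2 * fromℤ (ℤ.suc j) - 1#
        ≤⟨ +-monoˡ-≤ (- 1#) (*-monoˡ-≤ (proj₁ 0<fromℕ2) (fromℤ-mono (ℤ.i<j⇒suc[i]≤j j<i))) ⟩
      fromℕ 2 * fromℤ i - 1#  ∎)

  -- The partition of space into cells

  cellOf : ∀ {D} (x : ℝ^ D) → ∃ λ g → Cell g x
  cellOf x = tabulate (λ j → proj₁ (nearestEven (x j))) , λ j →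
    ≡.subst (λ z → fromℕ 2 * fromℤ z - 1# ≤ x j × x j < fromℕ 2 * fromℤ z + 1#)
      (≡.sym (Vec.lookup∘tabulate _ j)) (proj₂ (nearestEven (x j)))

  cell-unique : ∀ {D} {x : ℝ^ D} g h → Cell g x → Cell h x → g ≡ h
  cell-unique g h x∈g x∈h = ≡.trans (≡.sym (Vec.tabulate∘lookup g))
    (≡.trans (Vec.tabulate-cong λ j → ℤ.≤-antisym
        (nearestEven-≤ (proj₁ (x∈g j)) (proj₂ (x∈h j)))
        (nearestEven-≤ (proj₁ (x∈h j)) (proj₂ (x∈g j))))
      (Vec.tabulate∘lookup h))

  -- Norms

  sum-nonNeg : ∀ {n} (f : Fin n → ℝ) → (∀ i → 0# ≤ f i) → 0# ≤ sum f
  sum-nonNeg {zero}  f 0≤f = ≤-refl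
  sum-nonNeg {suc n} f 0≤f = +-nonNeg (0≤f zero) (sum-nonNeg (λ i → f (suc i)) (λ i → 0≤f (suc i)))

  ‖‖² : ∀ {D} (v : ℝ^ D) → ‖ v ‖ ^ 2 ≈ ⟨ v , v ⟩
  ‖‖² v = trans (*-congˡ (*-identityʳ _))
    (proj₂ (√-satisfies (sum-nonNeg (λ j → v j * v j) (λ j → square-nonNeg (v j)))))

  ‖‖-cong : ∀ {D} {u v : ℝ^ D} → u ≋ v → ‖ u ‖ ≈ ‖ v ‖
  ‖‖-cong {D} u≋v = √-cong (sum-cong-≋ {D} λ j → *-cong (u≋v j) (u≋v j))

  T-cong : ∀ {D} (x : ℝ^ D) {p q : ℝ^ D} → p ≋ q → T x p ≈ T x q
  T-cong x p≋q = exp-cong (-‿cong (^-congˡ 2 (‖‖-cong λ j → +-congˡ (-‿cong (p≋q j)))))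

  infixr 7 _·_

  _·_ : ∀ {D} → ℝ → ℝ^ D → ℝ^ D
  (b · x) j = b * x j

  ⟨·∸·⟩ : ∀ D b (x y : ℝ^ D) →
          ⟨ b · y ∸ᵛ b · x , b · y ∸ᵛ b · x ⟩ ≈ b * b * ⟨ x ∸ᵛ y , x ∸ᵛ y ⟩
  ⟨·∸·⟩ zero    b x y = sym (zeroʳ _)
  ⟨·∸·⟩ (suc D) b x y = begin-equality
    (b * y zero - b * x zero) * (b * y zero - b * x zero) + _
      ≈⟨ +-congˡ (⟨·∸·⟩ D b (λ j → x (suc j)) (λ j → y (suc j))) ⟩
    (b * y zero - b * x zero) * (b * y zero - b * x zero) + b * b * S
      ≈⟨ solve 4 (λ b x y S → (b :* y :- b :* x) :* (b :* y :- b :* x) :+ b :* b :* S := b :* b :* ((x :- y) :* (x :- y) :+ S)) refl b (x zero) (y zero) S ⟩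
    b * b * ((x zero - y zero) * (x zero - y zero) + S)  ∎
    where S = ∑[ j < D ] ((x (suc j) - y (suc j)) * (x (suc j) - y (suc j)))

  ⟨∸⟩ : ∀ D (x y : ℝ^ D) →
        ⟨ x ∸ᵛ y , x ∸ᵛ y ⟩ ≈ ⟨ x , x ⟩ + ⟨ y , y ⟩ - (⟨ x , y ⟩ + ⟨ x , y ⟩)
  ⟨∸⟩ zero    x y = solve 0 (:0 := :0 :+ :0 :- (:0 :+ :0)) refl
  ⟨∸⟩ (suc D) x y = trans (+-congˡ (⟨∸⟩ D x′ y′))
    (solve 5 (λ x y X Y Z → (x :- y) :* (x :- y) :+ (X :+ Y :- (Z :+ Z))
                := x :* x :+ X :+ (y :* y :+ Y) :- (x :* y :+ Z :+ (x :* y :+ Z)))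
       refl (x zero) (y zero) ⟨ x′ , x′ ⟩ ⟨ y′ , y′ ⟩ ⟨ x′ , y′ ⟩)
    where
    x′ y′ : ℝ^ D
    x′ j = x (suc j)
    y′ j = y (suc j)

  -- The arguments change places because `T` takes the point of the family second, whereas the
  -- signing bounds take it first.
  T-scaled : ∀ {D α} → 0# < α → (x y : ℝ^ D) →
             T (√ α · y) (√ α · x) ≈ exp (- (α * ‖ x ∸ᵛ y ‖ ^ 2))
  T-scaled {D} {α} 0<α x y = exp-cong (-‿cong (begin-equality
    ‖ √ α · y ∸ᵛ √ α · x ‖ ^ 2                     ≈⟨ ‖‖² (√ α · y ∸ᵛ √ α · x) ⟩
    ⟨ √ α · y ∸ᵛ √ α · x , √ α · y ∸ᵛ √ α · x ⟩    ≈⟨ ⟨·∸·⟩ D (√ α) x y ⟩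
    √ α * √ α * ⟨ x ∸ᵛ y , x ∸ᵛ y ⟩                ≈⟨ *-cong (proj₂ (√-satisfies (proj₁ 0<α))) (sym (‖‖² (x ∸ᵛ y))) ⟩
    α * ‖ x ∸ᵛ y ‖ ^ 2                             ∎))

  Sphere⇒⟨⟩ : ∀ {d} {x : ℝ^ (suc d)} → Sphere d x → ⟨ x , x ⟩ ≈ 1#
  Sphere⇒⟨⟩ {x = x} ‖x‖≈1 = begin-equality
    ⟨ x , x ⟩      ≈⟨ ‖‖² x ⟨
    ‖ x ‖ ^ 2      ≈⟨ ^-congˡ 2 ‖x‖≈1 ⟩
    1# * (1# * 1#) ≈⟨ solve 0 (:1 :* (:1 :* :1) := :1) refl ⟩
    1#             ∎

  T-exponential : ∀ {d α} → 0# < α → {x y : ℝ^ (suc d)} → Sphere d x → Sphere d y →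
                  T (√ (α / (1# + 1#)) · y) (√ (α / (1# + 1#)) · x) ≈ exponentialKernel α x y
  T-exponential {d} {α} 0<α {x} {y} x∈S y∈S =
    trans (T-scaled (/-pos 0<α 0<2) x y) (exp-cong (-‿cong (begin-equality
      β * ‖ x ∸ᵛ y ‖ ^ 2                                 ≈⟨ *-congˡ (trans (‖‖² (x ∸ᵛ y)) (⟨∸⟩ (suc d) x y)) ⟩
      β * (⟨ x , x ⟩ + ⟨ y , y ⟩ - (⟨ x , y ⟩ + ⟨ x , y ⟩)) ≈⟨ *-congˡ (+-congʳ (+-cong (Sphere⇒⟨⟩ {x = x} x∈S) (Sphere⇒⟨⟩ {x = y} y∈S))) ⟩
      β * (1# + 1# - (⟨ x , y ⟩ + ⟨ x , y ⟩))            ≈⟨ solve 2 (λ b z → b :* (:1 :+ :1 :- (z :+ z)) := (:1 :+ :1) :* b :* (:1 :- z)) refl β ⟨ x , y ⟩ ⟩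
      (1# + 1#) * β * (1# - ⟨ x , y ⟩)                   ≈⟨ *-congʳ (*-/ α 0<2) ⟩
      α * (1# - ⟨ x , y ⟩)                               ∎)))
    where β = α / (1# + 1#)

  -- Signings

  signedSum : ∀ {n} → (Fin n → Sign) → (Fin n → ℝ) → ℝ
  signedSum {n} σ f = ∑[ i < n ] (fromSign (σ i) * f i)

  fromSign-* : ∀ s t → fromSign (s Sign.* t) ≈ fromSign s * fromSign t
  fromSign-* Sign.+ t      = sym (*-identityˡ _)
  fromSign-* Sign.- Sign.+ = sym (*-identityʳ _)
  fromSign-* Sign.- Sign.- = solve 0 (:1 := :- :1 :* :- :1) refl

  ∣-∣≤1 : ∀ {x y} → 0# ≤ x → x ≤ 1# → 0# ≤ y → y ≤ 1# → ∣ x - y ∣ ≤ 1#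
  ∣-∣≤1 {x} {y} 0≤x x≤1 0≤y y≤1 = ∣∣-intro
    (≤-fromGap (+-nonNeg (gap x≤1) 0≤y)
      (solve 2 (λ x y → :1 :- (x :- y) := :1 :- x :+ y) refl x y))
    (≤-fromGap (+-nonNeg (gap y≤1) 0≤x)
      (solve 2 (λ x y → :1 :- :- (x :- y) := :1 :- y :+ x) refl x y))

  -- The sign is chosen so that the two terms have opposite signs; what remains is a difference of
  -- two numbers in [0, 1].
  balanceOne : ∀ {x y} → ∣ x ∣ ≤ 1# → ∣ y ∣ ≤ 1# → ∃ λ s → ∣ fromSign s * x + y ∣ ≤ 1#
  balanceOne {x} {y} ∣x∣≤1 ∣y∣≤1 with total 0# x | total 0# y | ∣∣-elim ∣x∣≤1 | ∣∣-elim ∣y∣≤1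
  ... | inj₁ 0≤x | inj₁ 0≤y | x≤1 , _ | y≤1 , _ = Sign.- , ∣∣-resp
    (solve 2 (λ x y → y :- x := :- :1 :* x :+ y) refl x y) (∣-∣≤1 0≤y y≤1 0≤x x≤1)
  ... | inj₁ 0≤x | inj₂ y≤0 | x≤1 , _ | _ , -y≤1 = Sign.+ , ∣∣-resp
    (solve 2 (λ x y → x :- :- y := :1 :* x :+ y) refl x y) (∣-∣≤1 0≤x x≤1 (neg-nonNeg y≤0) -y≤1)
  ... | inj₂ x≤0 | inj₁ 0≤y | _ , -x≤1 | y≤1 , _ = Sign.+ , ∣∣-resp
    (solve 2 (λ x y → y :- :- x := :1 :* x :+ y) refl x y) (∣-∣≤1 0≤y y≤1 (neg-nonNeg x≤0) -x≤1)
  ... | inj₂ x≤0 | inj₂ y≤0 | _ , -x≤1 | _ , -y≤1 = Sign.- , ∣∣-resp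
    (solve 2 (λ x y → :- x :- :- y := :- :1 :* x :+ y) refl x y)
    (∣-∣≤1 (neg-nonNeg x≤0) -x≤1 (neg-nonNeg y≤0) -y≤1)

  -- Greedy: each sign is chosen against the signed sum of the later terms, which already lies in
  -- [-1, 1].
  balance : ∀ {m} (s : Fin m → ℝ) → (∀ k → ∣ s k ∣ ≤ 1#) → ∃ λ ε → ∣ signedSum ε s ∣ ≤ 1#
  balance {zero}  s s≤1 = (λ ()) , ≤-trans ∣0∣≤0 0≤1
  balance {suc m} s s≤1 =
    let (ε , εs≤1)  = balance (λ k → s (suc k)) (λ k → s≤1 (suc k))
        (e , εs≤1′) = balanceOne (s≤1 zero) εs≤1
    in (λ { zero → e ; (suc k) → ε k }) , εs≤1′

  sum-select : ∀ {m} (j : Fin m) (b : Fin m → Bool) (f : Fin m → ℝ) →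
               b j ≡ true → (∀ k → j ≢ k → b k ≡ false) →
               ∑[ k < m ] (if b k then f k else 0#) ≈ f j
  sum-select {suc m} j b f bj≡true bk≡false = begin-equality
    sum t                                  ≈⟨ sum-remove {i = j} t ⟩
    t j + ∑[ k < m ] t (punchIn j k)       ≈⟨ +-cong
      (reflexive (≡.cong (if_then f j else 0#) bj≡true))
      (sum-cong-≋ {m} λ k → reflexive (≡.cong (if_then f (punchIn j k) else 0#)
        (bk≡false (punchIn j k) λ j≡ → Fin.punchInᵢ≢i j k (≡.sym j≡)))) ⟩
    f j + ∑[ k < m ] 0#                    ≈⟨ +-congˡ (sum-replicate-zero m) ⟩
    f j + 0#                               ≈⟨ +-identityʳ _ ⟩
    f j                                    ∎
    where
    t : Fin (suc m) → ℝ
    t k = if b k then f k else 0#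

  sumOver-cong : ∀ {n} (S : Subset n) {f g : Fin n → ℝ} → (∀ i → f i ≈ g i) → sumOver S f ≈ sumOver S g
  sumOver-cong {n} S {f} {g} f≈g = sum-cong-≋ {n} λ i → pointwise (lookup S i) i
    where
    pointwise : ∀ b i → (if b then f i else 0#) ≈ (if b then g i else 0#)
    pointwise true  i = f≈g i
    pointwise false i = refl

  sumOver-*ˡ : ∀ {n} (S : Subset n) c (f : Fin n → ℝ) → sumOver S (λ i → c * f i) ≈ c * sumOver S f
  sumOver-*ˡ {n} S c f = sym (trans (*-distribˡ-sum c (λ i → if lookup S i then f i else 0#))
    (sum-cong-≋ {n} λ i → pointwise (lookup S i) i))
    where
    pointwise : ∀ b i → c * (if b then f i else 0#) ≈ (if b then c * f i else 0#)
    pointwise true  i = refl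
    pointwise false i = zeroʳ c

  -- Each term is expanded into a sum over all parts in which only its own part survives, and the
  -- two sums are exchanged. The summand may depend on the part because every cell comes with its
  -- own signing of the whole family.
  sum-partition : ∀ {m n} (S : Fin m → Subset n) (c : Fin n → Fin m) (a : Fin m → Fin n → ℝ) →
                  (∀ i → lookup (S (c i)) i ≡ true) →
                  (∀ i k → c i ≢ k → lookup (S k) i ≡ false) →
                  ∑[ i < n ] a (c i) i ≈ ∑[ k < m ] sumOver (S k) (a k)
  sum-partition {m} {n} S c a in-own only-own = trans
    (sum-cong-≋ {n} λ i → sym (sum-select (c i) (λ k → lookup (S k) i) (λ k → a k i) (in-own i) (only-own i)))
    (∑-comm (λ i k → if lookup (S k) i then a k i else 0#))

  -- The values of `f`, each listed once. For `f` sending a point to its cell these are the occupied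
  -- cells, in the injective form in which the envelopes can be summed.
  record Classes {A : Set} {n} (f : Fin n → A) : Set where
    field
      m         : ℕ
      class     : Fin m → A
      injective : Injective _≡_ _≡_ class
      index     : Fin n → Fin m
      class∘index : ∀ i → class (index i) ≡ f i

  classes : ∀ {A : Set} {n} (f : Fin n → A) → Classes f
  classes {n = zero}  f = record
    { m = 0 ; class = λ () ; injective = λ { {()} } ; index = λ () ; class∘index = λ () }
  classes {n = suc n} f with classes (λ i → f (suc i))
  ... | C with em {∃ λ k → Classes.class C k ≡ f zero}
  ... | yes (k , k-class) = record
    { m = Classes.m C ; class = Classes.class C ; injective = Classes.injective C
    ; index = λ { zero → k ; (suc i) → Classes.index C i }
    ; class∘index = λ { zero → k-class ; (suc i) → Classes.class∘index C i }
    }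
  ... | no new = record
    { m = suc (Classes.m C)
    ; class = λ { zero → f zero ; (suc k) → Classes.class C k }
    ; injective = λ
      { {zero}  {zero}  _ → ≡.refl
      ; {zero}  {suc l} p → contradiction (l , ≡.sym p) new
      ; {suc k} {zero}  p → contradiction (k , p) new
      ; {suc k} {suc l} p → ≡.cong suc (Classes.injective C p)
      }
    ; index = λ { zero → zero ; (suc i) → suc (Classes.index C i) }
    ; class∘index = λ { zero → ≡.refl ; (suc i) → Classes.class∘index C i }
    }

  does-em-true : {P : Set} → P → does (em {P}) ≡ true
  does-em-true {P} p with em {P}
  ... | yes _  = ≡.refl
  ... | no  ¬p = contradiction p ¬p

  does-em-false : {P : Set} → ¬ P → does (em {P}) ≡ false
  does-em-false {P} ¬p with em {P}
  ... | yes p = contradiction p ¬p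
  ... | no  _ = ≡.refl

  cellPart-true : ∀ {D n} (p : Fin n → ℝ^ D) g i → Cell g (p i) → lookup (cellPart p g) i ≡ true
  cellPart-true p g i i∈g = ≡.trans (Vec.lookup∘tabulate _ i) (does-em-true i∈g)

  cellPart-false : ∀ {D n} (p : Fin n → ℝ^ D) g i → ¬ Cell g (p i) → lookup (cellPart p g) i ≡ false
  cellPart-false p g i i∉g = ≡.trans (Vec.lookup∘tabulate _ i) (does-em-false i∉g)

  -- The index type `I` of evaluation points is left open: it is all of Euclidean space for `T`, and
  -- the points of the domain for the two kernels.
  Signing : ∀ {n} {I : Set} → ℝ → (I → Fin n → ℝ) → Set
  Signing {n} b f = ∃ λ (σ : Fin n → Sign) →
    ∣ signedSum σ (λ _ → 1#) ∣ ≤ 1# × (∀ y → ∣ signedSum σ (f y) ∣ ≤ b)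

  -- Balanced signings for Tai's kernel

  module Tai {D} (tai : TaiConstant D) where

    open TaiConstant tai

    -- Negating the signing of a whole cell keeps its bound, so that the imbalances
    -- of the cells can be made to cancel.
    distinctSigning : ∀ {n} (p : Fin n → ℝ^ D) → Injective _≡_ _≋_ p →
                      Signing fT (λ x i → T x (p i))
    distinctSigning {n} p p-injective = σ ,
      ∣∣-resp (sym (trans (cellwise (λ _ → 1#)) (sum-cong-≋ {m} λ k →
        *-congˡ (sumOver-cong (part k) λ i → *-identityʳ _)))) (proj₂ balanced) ,
      λ x → ∣∣-resp (sym (cellwise (λ i → T x (p i)))) (≤-trans
        (∣∣-sum _ (λ k → cellEnvelope C (class k) x) λ k →
          ∣∣-sign (ε k) (proj₁ (proj₂ (cellSigning n p p-injective (class k))) x))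
        (cellSum x m class injective))
      where
      open Classes (classes (λ i → proj₁ (cellOf (p i))))

      part : Fin m → Subset n
      part k = cellPart p (class k)

      τ : Fin m → Fin n → Sign
      τ k = proj₁ (cellSigning n p p-injective (class k))

      balanced = balance (λ k → sumOver (part k) (λ i → fromSign (τ k i)))
        (λ k → proj₂ (proj₂ (cellSigning n p p-injective (class k))))

      ε : Fin m → Sign
      ε = proj₁ balanced

      σ : Fin n → Sign
      σ i = ε (index i) Sign.* τ (index i) i

      in-own : ∀ i → Cell (class (index i)) (p i)
      in-own i = ≡.subst (λ g → Cell g (p i)) (≡.sym (class∘index i)) (proj₂ (cellOf (p i)))

      -- Stated for every `f` so that the constant 1 yields the balance and `T x` yields the
      -- discrepancy bound. The parts are disjoint because cells are unique and `class` is
      -- injective.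
      cellwise : ∀ f → signedSum σ f ≈ signedSum ε (λ k → sumOver (part k) (λ i → fromSign (τ k i) * f i))
      cellwise f = begin-equality
        signedSum σ f
          ≈⟨ sum-cong-≋ {n} (λ i → trans (*-congʳ (fromSign-* (ε (index i)) (τ (index i) i))) (*-assoc _ _ _)) ⟩
        ∑[ i < n ] (fromSign (ε (index i)) * (fromSign (τ (index i) i) * f i))
          ≈⟨ sum-partition part index (λ k i → fromSign (ε k) * (fromSign (τ k i) * f i))
               (λ i → cellPart-true p (class (index i)) i (in-own i))
               (λ i k i≢k → cellPart-false p (class k) i λ i∈k →
                 i≢k (injective (cell-unique (class (index i)) (class k) (in-own i) i∈k))) ⟩
        ∑[ k < m ] sumOver (part k) (λ i → fromSign (ε k) * (fromSign (τ k i) * f i))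
          ≈⟨ sum-cong-≋ {m} (λ k → sumOver-*ˡ (part k) (fromSign (ε k)) (λ i → fromSign (τ k i) * f i)) ⟩
        signedSum ε (λ k → sumOver (part k) (λ i → fromSign (τ k i) * f i))  ∎

    module _ {n} (p : Fin (suc (suc n)) → ℝ^ D) (i j : Fin (suc (suc n))) (i≢j : i ≢ j) (pi≋pj : p i ≋ p j) where

      others : Fin n → Fin (suc (suc n))
      others k = punchIn i (punchIn (punchOut i≢j) k)

      oppositePair : (Fin n → Sign) → Fin (suc (suc n)) → Sign
      oppositePair τ = insertAt (insertAt τ (punchOut i≢j) Sign.-) i Sign.+

      signedSum-oppositePair : ∀ τ (f : Fin (suc (suc n)) → ℝ) → f i ≈ f j →
                               signedSum (oppositePair τ) f ≈ signedSum τ (λ k → f (others k))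
      signedSum-oppositePair τ f fi≈fj = begin-equality
        sum t
          ≈⟨ sum-remove {i = i} t ⟩
        t i + sum (removeAt t i)
          ≈⟨ +-congˡ (sum-remove {i = j′} (removeAt t i)) ⟩
        t i + (t (punchIn i j′) + ∑[ k < n ] t (others k))
          ≈⟨ +-cong (*-cong (reflexive (≡.cong fromSign sign-i)) fi≈fj)
               (+-cong (*-cong (reflexive (≡.cong fromSign sign-j)) (reflexive (≡.cong f (Fin.punchIn-punchOut i≢j))))
                 (sum-cong-≋ {n} λ k → *-congʳ (reflexive (≡.cong fromSign (sign-others k))))) ⟩
        1# * f j + (- 1# * f j + signedSum τ (λ k → f (others k)))
          ≈⟨ solve 2 (λ x s → :1 :* x :+ (:- :1 :* x :+ s) := s) refl (f j) _ ⟩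
        signedSum τ (λ k → f (others k))  ∎
        where
        j′ = punchOut i≢j
        t : Fin (suc (suc n)) → ℝ
        t k = fromSign (oppositePair τ k) * f k

        sign-i : oppositePair τ i ≡ Sign.+
        sign-i = insertAt-lookup _ i Sign.+

        sign-j : oppositePair τ (punchIn i j′) ≡ Sign.-
        sign-j = ≡.trans (insertAt-punchIn _ i Sign.+ j′) (insertAt-lookup τ j′ Sign.-)

        sign-others : ∀ k → oppositePair τ (others k) ≡ τ k
        sign-others k = ≡.trans (insertAt-punchIn _ i Sign.+ (punchIn j′ k)) (insertAt-punchIn τ j′ Sign.- k)

    -- A removed pair contributes 0 to every signed sum in question, so the bound does not grow
    -- along the recursion.
    signing : ∀ n (p : Fin n → ℝ^ D) → Signing fT (λ x i → T x (p i))
    signing n p with em {∃ λ i → ∃ λ j → i ≢ j × p i ≋ p j}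
    signing n p | no  distinct = distinctSigning p injective
      where
      injective : Injective _≡_ _≋_ p
      injective {i} {j} pi≋pj with i Fin.≟ j
      ... | yes i≡j = i≡j
      ... | no  i≢j = contradiction (i , j , i≢j , pi≋pj) distinct
    signing (suc zero)    p | yes (zero , zero , 0≢0 , _) = contradiction ≡.refl 0≢0
    signing (suc (suc n)) p | yes (i , j , i≢j , pi≋pj)   =
      let (τ , balanced , small) = signing n (λ k → p (others p i j i≢j pi≋pj k))
          flatten = signedSum-oppositePair p i j i≢j pi≋pj τ
      in oppositePair p i j i≢j pi≋pj τ ,
         ∣∣-resp (sym (flatten (λ _ → 1#) refl)) balanced ,
         λ x → ∣∣-resp (sym (flatten (λ k → T x (p k)) (T-cong x pi≋pj))) (small x)

    -- A single point is all of its cell's part, so Tai's two bounds already bound T; no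
    -- property of exp is needed.
    ∣T∣≤fT : ∀ (x p : ℝ^ D) → ∣ T x p ∣ ≤ fT
    ∣T∣≤fT x p = ≤-trans
      (∣∣-unsign (σ zero) (∣∣-resp (begin-equality
        sumOver (cellPart (λ _ → p) g) (λ i → fromSign (σ i) * T x p)  ≈⟨ +-identityʳ _ ⟩
        (if lookup (cellPart {n = 1} (λ _ → p) g) zero then fromSign (σ zero) * T x p else 0#)
          ≡⟨ ≡.cong (if_then fromSign (σ zero) * T x p else 0#) (cellPart-true {n = 1} (λ _ → p) g zero (proj₂ (cellOf p))) ⟩
        fromSign (σ zero) * T x p  ∎) (proj₁ (proj₂ tai₁) x)))
      (≤-trans (≤-reflexive (sym (+-identityʳ _)))
        (cellSum x 1 (λ _ → g) (λ { {zero} {zero} _ → ≡.refl })))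
      where
      g = proj₁ (cellOf p)
      tai₁ = cellSigning 1 (λ _ → p) (λ { {zero} {zero} _ → ≡.refl }) g
      σ = proj₁ tai₁

      ∣∣-unsign : ∀ s {y b} → ∣ fromSign s * y ∣ ≤ b → ∣ y ∣ ≤ b
      ∣∣-unsign Sign.+ {y} ∣y∣≤b = ∣∣-resp (*-identityˡ y) ∣y∣≤b
      ∣∣-unsign Sign.- {y} ∣-y∣≤b = ∣∣-resp (solve 1 (λ y → :- (:- :1 :* y) := y) refl y) (∣∣-neg ∣-y∣≤b)

    -- The empty family of cells has envelope sum 0.
    0≤fT : 0# ≤ fT
    0≤fT = cellSum (λ _ → 0#) 0 (λ ()) (λ { {()} })

  -- Subsets of subsets

  -- Reindexes a chosen half as a family over `Fin (card S)`, so that it can be halved again;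
  -- `embed` takes the result back to the original indices.
  enum : ∀ {n} (S : Subset n) → Fin (card S) → Fin n
  enum (true  ∷ S) zero    = zero
  enum (true  ∷ S) (suc k) = suc (enum S k)
  enum (false ∷ S) k       = suc (enum S k)

  embed : ∀ {n} (S : Subset n) → Subset (card S) → Subset n
  embed []          []      = []
  embed (true  ∷ S) (b ∷ R) = b ∷ embed S R
  embed (false ∷ S) R       = false ∷ embed S R

  card-embed : ∀ {n} (S : Subset n) (R : Subset (card S)) → card (embed S R) ≡ card R
  card-embed []          []          = ≡.refl
  card-embed (true  ∷ S) (true  ∷ R) = ≡.cong suc (card-embed S R)
  card-embed (true  ∷ S) (false ∷ R) = card-embed S R
  card-embed (false ∷ S) R           = card-embed S R

  sumOver-embed : ∀ {n} (S : Subset n) (R : Subset (card S)) (f : Fin n → ℝ) →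
                  sumOver (embed S R) f ≈ sumOver R (λ k → f (enum S k))
  sumOver-embed []          []      f = refl
  sumOver-embed (true  ∷ S) (b ∷ R) f = +-congˡ (sumOver-embed S R (λ i → f (suc i)))
  sumOver-embed (false ∷ S) R       f = trans (+-identityˡ _) (sumOver-embed S R (λ i → f (suc i)))

  sum-enum : ∀ {n} (S : Subset n) (f : Fin n → ℝ) → sum (λ k → f (enum S k)) ≈ sumOver S f
  sum-enum []          f = refl
  sum-enum (true  ∷ S) f = +-congˡ (sum-enum S (λ i → f (suc i)))
  sum-enum (false ∷ S) f = trans (sum-enum S (λ i → f (suc i))) (sym (+-identityˡ _))

  fromℕ-card : ∀ {n} (S : Subset n) → fromℕ (card S) ≈ sumOver S (λ _ → 1#)
  fromℕ-card []          = refl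
  fromℕ-card (true  ∷ S) = +-congˡ (fromℕ-card S)
  fromℕ-card (false ∷ S) = trans (fromℕ-card S) (sym (+-identityˡ _))

  sumOver-⊤ : ∀ {n} (f : Fin n → ℝ) → sumOver ⊤ f ≈ sum f
  sumOver-⊤ {zero}  f = refl
  sumOver-⊤ {suc n} f = +-congˡ (sumOver-⊤ (λ i → f (suc i)))

  card>0⇒Nonempty : ∀ {n} (S : Subset n) → 0 ℕ.< card S → Nonempty S
  card>0⇒Nonempty (true  ∷ S) _ = zero , here
  card>0⇒Nonempty (false ∷ S) 0<card = let (i , i∈S) = card>0⇒Nonempty S 0<card in suc i , there i∈S

  average : ∀ {n} → (Fin n → ℝ) → ℝ
  average {n} f = sum f / fromℕ n

  averageOver : ∀ {n} → Subset n → (Fin n → ℝ) → ℝ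
  averageOver S f = sumOver S f / fromℕ (card S)

  averageOver-⊤ : ∀ {n} (f : Fin n → ℝ) → averageOver ⊤ f ≈ average f
  averageOver-⊤ {n} f = /-cong (sumOver-⊤ f) (reflexive (≡.cong fromℕ (Subset.∣⊤∣≡n n)))

  averageOver-embed : ∀ {n} (S : Subset n) (R : Subset (card S)) (f : Fin n → ℝ) →
                      averageOver (embed S R) f ≈ averageOver R (λ k → f (enum S k))
  averageOver-embed S R f = /-cong (sumOver-embed S R f) (reflexive (≡.cong fromℕ (card-embed S R)))

  average-enum : ∀ {n} (S : Subset n) (f : Fin n → ℝ) → average (λ k → f (enum S k)) ≈ averageOver S f
  average-enum S f = *-congʳ (sum-enum S f)

  -- Halving

  isPlus : Sign → Bool
  isPlus Sign.+ = true
  isPlus Sign.- = false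

  plus : ∀ {n} → (Fin n → Sign) → Subset n
  plus σ = tabulate λ i → isPlus (σ i)

  -- The weight 1 + σᵢ is 2 on the plus set and 0 elsewhere; doubling the left side avoids a
  -- division.
  sumOver-plus : ∀ {n} (σ : Fin n → Sign) f → sumOver (plus σ) f + sumOver (plus σ) f ≈ sum f + signedSum σ f
  sumOver-plus {n} σ f = trans (sym (∑-distrib-+ g g))
    (trans (sum-cong-≋ {n} λ i → trans
        (reflexive (≡.cong (λ b → (if b then f i else 0#) + (if b then f i else 0#)) (Vec.lookup∘tabulate _ i)))
        (pointwise (σ i) (f i)))
      (∑-distrib-+ f (λ i → fromSign (σ i) * f i)))
    where
    g : Fin n → ℝ
    g i = if lookup (plus σ) i then f i else 0#

    pointwise : ∀ s x → (if isPlus s then x else 0#) + (if isPlus s then x else 0#) ≈ x + fromSign s * x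
    pointwise Sign.+ x = solve 1 (λ x → x :+ x := x :+ :1 :* x) refl x
    pointwise Sign.- x = solve 1 (λ x → :0 :+ :0 := x :+ :- :1 :* x) refl x

  flip : ∀ {n} → (Fin n → Sign) → Fin n → Sign
  flip σ i = Sign.opposite (σ i)

  signedSum-flip : ∀ {n} (σ : Fin n → Sign) f → signedSum (flip σ) f ≈ - signedSum σ f
  signedSum-flip {zero}  σ f = sym -0#≈0#
  signedSum-flip {suc n} σ f = begin-equality
    fromSign (flip σ zero) * f zero + signedSum (flip σ′) f′
      ≈⟨ +-cong (pointwise (σ zero) (f zero)) (signedSum-flip σ′ f′) ⟩
    - (fromSign (σ zero) * f zero) - signedSum σ′ f′
      ≈⟨ ⁻¹-∙-comm _ _ ⟩
    - signedSum σ f  ∎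
    where
    σ′ : Fin n → Sign
    σ′ i = σ (suc i)

    f′ : Fin n → ℝ
    f′ i = f (suc i)

    pointwise : ∀ s x → fromSign (Sign.opposite s) * x ≈ - (fromSign s * x)
    pointwise Sign.+ x = sym (-‿distribˡ-* 1# x)
    pointwise Sign.- x = solve 1 (λ x → :1 :* x := :- (:- :1 :* x)) refl x

  -- With s = 2 m − n and d = 2 a′ − a, the error a′ / m − a / n is (n d − s a) / (2 m n).
  averageError : ∀ {M N s a a′ d b u v F} → 0# ≤ N → 0# < N → 0# < M → 0# ≤ b →
                 0# ≤ s → s ≤ 1# → M + M ≈ N + s → a′ + a′ ≈ a + d →
                 d ≤ b → - a ≤ N * b → N * u ≈ a → M * v ≈ a′ → N * F ≈ b + b → v - u ≤ F
  averageError {M} {N} {s} {a} {a′} {d} {b} {u} {v} {F} 0≤N 0<N 0<M 0≤b 0≤s s≤1 2M≈N+s 2a′≈a+d d≤b -a≤Nb Nu≈a Mv≈a′ NF≈2b =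
    *-cancelˡ-≤ 0<N (*-cancelˡ-≤ (+-pos 0<M (proj₁ 0<M)) (begin
      (M + M) * (N * (v - u))
        ≈⟨ solve 4 (λ M N v u → (M :+ M) :* (N :* (v :- u)) := N :* (M :* v :+ M :* v) :- (M :+ M) :* (N :* u)) refl M N v u ⟩
      N * (M * v + M * v) - (M + M) * (N * u)
        ≈⟨ +-cong (*-congˡ (trans (+-cong Mv≈a′ Mv≈a′) 2a′≈a+d)) (-‿cong (*-cong 2M≈N+s Nu≈a)) ⟩
      N * (a + d) - (N + s) * a
        ≈⟨ solve 4 (λ N a d s → N :* (a :+ d) :- (N :+ s) :* a := N :* d :+ s :* :- a) refl N a d s ⟩
      N * d + s * - a
        ≤⟨ +-mono-≤ (*-monoˡ-≤ 0≤N d≤b) (≤-trans (*-monoˡ-≤ 0≤s -a≤Nb) (*-monoʳ-≤ (*-nonNeg 0≤N 0≤b) s≤1)) ⟩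
      N * b + 1# * (N * b)
        ≈⟨ solve 2 (λ N b → N :* b :+ :1 :* (N :* b) := N :* (b :+ b)) refl N b ⟩
      N * (b + b)
        -- This is where keeping the larger half matters: s ≥ 0 gives N ≤ 2M.
        ≤⟨ *-monoʳ-≤ (+-nonNeg 0≤b 0≤b) (≤-trans (≤-fromGap 0≤s (solve 2 (λ N s → N :+ s :- N := s) refl N s)) (≤-reflexive (sym 2M≈N+s))) ⟩
      (M + M) * (b + b)
        ≈⟨ *-congˡ NF≈2b ⟨
      (M + M) * (N * F)  ∎))

  ∣∣-sum-const : ∀ {n b} (f : Fin n → ℝ) → (∀ i → ∣ f i ∣ ≤ b) → ∣ sum f ∣ ≤ fromℕ n * b
  ∣∣-sum-const {zero}  f f≤b = ≤-trans ∣0∣≤0 (≤-reflexive (sym (zeroˡ _)))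
  ∣∣-sum-const {suc n} f f≤b = ≤-trans (∣∣-+ (f≤b zero) (∣∣-sum-const (λ i → f (suc i)) (λ i → f≤b (suc i))))
    (≤-reflexive (solve 2 (λ n b → b :+ n :* b := (:1 :+ n) :* b) refl (fromℕ n) _))

  sum-ones : ∀ n → sum {n} (λ _ → 1#) ≈ fromℕ n
  sum-ones zero    = refl
  sum-ones (suc n) = +-congˡ (sum-ones n)

  -- Flipping all signs if necessary makes the plus set the larger half; its excess 2|S| - n is the
  -- plain sum of the signs.
  excessSigning : ∀ {n I b} {f : I → Fin n → ℝ} → Signing b f →
                  ∃ λ (σ : Fin n → Sign) → 0# ≤ signedSum σ (λ _ → 1#) ×
                    signedSum σ (λ _ → 1#) ≤ 1# × (∀ y → ∣ signedSum σ (f y) ∣ ≤ b)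
  excessSigning {f = f} (σ , balanced , small) = orient (total 0# s) (∣∣-elim balanced)
    where
    s = signedSum σ (λ _ → 1#)

    orient : 0# ≤ s ⊎ s ≤ 0# → s ≤ 1# × - s ≤ 1# → _
    orient (inj₁ 0≤s) (s≤1 , _)  = σ , 0≤s , s≤1 , small
    orient (inj₂ s≤0) (_ , -s≤1) = flip σ ,
      ≤-trans (neg-nonNeg s≤0) (≤-reflexive (sym (signedSum-flip σ (λ _ → 1#)))) ,
      ≤-trans (≤-reflexive (signedSum-flip σ (λ _ → 1#))) -s≤1 ,
      λ y → ∣∣-resp (sym (signedSum-flip σ (f y))) (∣∣-neg (small y))

  -- One `b / n` pays for the signed sum, the other for dividing by |S| in place of n/2; the latter
  -- uses the pointwise bound on `f`.
  halving : ∀ {n I b} (f : I → Fin n → ℝ) → 0 ℕ.< n → 0# ≤ b → Signing b f → (∀ y i → ∣ f y i ∣ ≤ b) →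
            ∃ λ (S : Subset n) →
              fromℕ n ≤ fromℕ (card S) + fromℕ (card S) ×
              fromℕ (card S) + fromℕ (card S) ≤ fromℕ n + 1# ×
              (∀ y → ∣ averageOver S (f y) - average (f y) ∣ ≤ (b + b) / fromℕ n)
  halving {n} {I} {b} f 0<n 0≤b signed f≤b = S , N≤2M ,
    ≤-trans (≤-reflexive 2M≈N+s) (+-mono-≤ ≤-refl s≤1) , error
    where
    σ     = proj₁ (excessSigning signed)
    0≤s   = proj₁ (proj₂ (excessSigning signed))
    s≤1   = proj₁ (proj₂ (proj₂ (excessSigning signed)))
    small = proj₂ (proj₂ (proj₂ (excessSigning signed)))
    s     = signedSum σ (λ _ → 1#)
    S     = plus σ
    N     = fromℕ n
    M     = fromℕ (card S)

    0<N : 0# < N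
    0<N = fromℕ-pos n 0<n

    2M≈N+s : M + M ≈ N + s
    2M≈N+s = trans (+-cong (fromℕ-card S) (fromℕ-card S))
      (trans (sumOver-plus σ (λ _ → 1#)) (+-congʳ (sum-ones n)))

    N≤2M : N ≤ M + M
    N≤2M = ≤-trans (≤-fromGap 0≤s (solve 2 (λ N s → N :+ s :- N := s) refl N s)) (≤-reflexive (sym 2M≈N+s))

    0<M : 0# < M
    0<M = ≰⇒> λ M≤0 → <⇒≱ 0<N (≤-trans N≤2M (≤-trans (+-mono-≤ M≤0 M≤0) (≤-reflexive (+-identityˡ 0#))))

    error : ∀ y → ∣ averageOver S (f y) - average (f y) ∣ ≤ (b + b) / N
    error y = ∣∣-intro
      (averageError (proj₁ 0<N) 0<N 0<M 0≤b 0≤s s≤1 2M≈N+s 2a′≈a+d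
        (proj₁ d-bound) (proj₂ a-bound) (*-/ a 0<N) (*-/ a′ 0<M) (*-/ (b + b) 0<N))
      -- The lower bound is the upper bound for the negated function: sums, signed sum and averages
      -- all change sign.
      (≤-trans (≤-reflexive (sym (⁻¹-∙-comm v (- u))))
        (averageError (proj₁ 0<N) 0<N 0<M 0≤b 0≤s s≤1 2M≈N+s
          (trans (⁻¹-∙-comm a′ a′) (trans (-‿cong 2a′≈a+d) (sym (⁻¹-∙-comm a d))))
          (proj₂ d-bound) (≤-trans (≤-reflexive (-‿involutive a)) (proj₁ a-bound))
          (trans (sym (-‿distribʳ-* N u)) (-‿cong (*-/ a 0<N)))
          (trans (sym (-‿distribʳ-* M v)) (-‿cong (*-/ a′ 0<M)))
          (*-/ (b + b) 0<N)))
      where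
      a  = sum (f y)
      a′ = sumOver S (f y)
      d  = signedSum σ (f y)
      u  = average (f y)
      v  = averageOver S (f y)
      2a′≈a+d = sumOver-plus σ (f y)
      d-bound = ∣∣-elim (small y)
      a-bound = ∣∣-elim (∣∣-sum-const (f y) (f≤b y))

  -- Coresets

  -- One halving step from n to m points costs 2b / n; here B = 2b, and δ is the
  -- error still allowed at m points.
  slack-halve : ∀ {M N B δ} → 0# < M → 0# ≤ B → fromℕ 3 ≤ N → M + M ≤ N + 1# → B + B ≤ M * δ → B + (B + B) ≤ N * δ
  slack-halve {M} {N} {B} {δ} 0<M 0≤B 3≤N 2M≤N+1 2B≤Mδ = *-cancelˡ-≤ 0<2 (begin
    (1# + 1#) * (B + (B + B))  ≈⟨ solve 1 (λ B → (:1 :+ :1) :* (B :+ (B :+ B)) := (:1 :+ :1 :+ :1) :* (B :+ B)) refl B ⟩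
    (1# + 1# + 1#) * (B + B)   ≤⟨ *-monoˡ-≤ (+-nonNeg (proj₁ 0<2) 0≤1) 2B≤Mδ ⟩
    (1# + 1# + 1#) * (M * δ)   ≈⟨ *-assoc _ M δ ⟨
    (1# + 1# + 1#) * M * δ     ≤⟨ *-monoʳ-≤ 0≤δ 3M≤2N ⟩
    (1# + 1#) * N * δ          ≈⟨ *-assoc _ N δ ⟩
    (1# + 1#) * (N * δ)        ∎)
    where
    0≤δ : 0# ≤ δ
    0≤δ = *-cancelˡ-≤ 0<M (≤-trans (≤-reflexive (zeroʳ M)) (≤-trans (+-nonNeg 0≤B 0≤B) 2B≤Mδ))

    3M≤2N : (1# + 1# + 1#) * M ≤ (1# + 1#) * N
    3M≤2N = *-cancelˡ-≤ 0<2 (≤-fromGap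
      (+-nonNeg (*-nonNeg (+-nonNeg (proj₁ 0<2) 0≤1) (gap 2M≤N+1)) (gap 3≤N))
      (solve 2 (λ M N → (:1 :+ :1) :* ((:1 :+ :1) :* N) :- (:1 :+ :1) :* ((:1 :+ :1 :+ :1) :* M)
         := (:1 :+ :1 :+ :1) :* (N :+ :1 :- (M :+ M)) :+ (N :- (:1 :+ (:1 :+ (:1 :+ :0))))) refl M N))

  module Coreset {D} (X : ℝ^ D → Set) (K : Kernel D) (b : ℝ) (0≤b : 0# ≤ b)
    (signing : ∀ n (x : Fin n → ℝ^ D) → (∀ i → X (x i)) →
               Signing {I = ∃ X} b (λ (y , _) i → K (x i) y))
    (K≤b : ∀ {x y} → X x → X y → ∣ K x y ∣ ≤ b) where

    -- One halving of n points costs `B / n`. In `c`, the part 3B pays for the last halving (B) and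
    -- opens the slack (2B); the part 3 forces n ≥ 3 whenever a halving takes place, since ε ≤ 1.
    B c : ℝ
    B = b + b
    c = B + (B + B) + fromℕ 3

    0≤B : 0# ≤ B
    0≤B = +-nonNeg 0≤b 0≤b

    3≤c : fromℕ 3 ≤ c
    3≤c = ≤-fromGap (+-nonNeg 0≤B (+-nonNeg 0≤B 0≤B))
      (solve 2 (λ x y → x :+ y :- y := x) refl (B + (B + B)) (fromℕ 3))

    3B≤c : B + (B + B) ≤ c
    3B≤c = ≤-fromGap (fromℕ-nonNeg 3)
      (solve 2 (λ x y → x :+ y :- x := y) refl (B + (B + B)) (fromℕ 3))

    module _ {ε} (0<ε : 0# < ε) (ε≤1 : ε ≤ 1#) where

      -- The second alternative strengthens E ≤ ε by a slack of 2B / n, which pays for the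
      -- halvings still to come.
      coreset : ∀ n → ℕ.Acc ℕ._<_ n → 0 ℕ.< n → (x : Fin n → ℝ^ D) → (∀ i → X (x i)) →
        ∃ λ (S : Subset n) → ∃ λ E →
          0 ℕ.< card S × ε * fromℕ (card S) ≤ c ×
          (∀ y → X y → ∣ averageOver S (λ i → K (x i) y) - average (λ i → K (x i) y) ∣ ≤ E) ×
          (E ≤ 0# ⊎ fromℕ n * E + (B + B) ≤ fromℕ n * ε)
      coreset n (ℕ.acc smaller) 0<n x x∈X with ≤⊎> (ε * fromℕ n) c
      ... | inj₁ εn≤c = ⊤ , 0# ,
        ≡.subst (0 ℕ.<_) (≡.sym (Subset.∣⊤∣≡n n)) 0<n ,
        ≤-trans (≤-reflexive (*-congˡ (reflexive (≡.cong fromℕ (Subset.∣⊤∣≡n n))))) εn≤c ,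
        (λ y _ → ∣∣-resp (sym (trans (+-congʳ (averageOver-⊤ (λ i → K (x i) y))) (-‿inverseʳ _))) ∣0∣≤0) ,
        -- No slack can be promised here, as ε n may be below 2B; the next level up creates it from
        -- c < ε n.
        inj₁ ≤-refl
      ... | inj₂ c<εn = embed S R , E + F ,
        ≡.subst (0 ℕ.<_) (≡.sym (card-embed S R)) 0<R ,
        ≤-trans (≤-reflexive (*-congˡ (reflexive (≡.cong fromℕ (card-embed S R))))) εR≤c ,
        (λ y y∈X → let f = λ i → K (x i) y in
          ∣∣-resp (begin-equality
            (averageOver R (λ k → f (enum S k)) - average (λ k → f (enum S k))) + (averageOver S f - average f)
              ≈⟨ +-cong (+-cong (sym (averageOver-embed S R f)) (-‿cong (average-enum S f))) refl ⟩
            (averageOver (embed S R) f - averageOver S f) + (averageOver S f - average f)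
              ≈⟨ solve 3 (λ p q r → (p :- q) :+ (q :- r) := p :- r) refl (averageOver (embed S R) f) (averageOver S f) (average f) ⟩
            averageOver (embed S R) f - average f  ∎)
            (∣∣-+ (errR y y∈X) (errS (y , y∈X)))) ,
        inj₂ (slack slackR)
        where
        N = fromℕ n

        0<N : 0# < N
        0<N = fromℕ-pos n 0<n

        3≤N : fromℕ 3 ≤ N
        3≤N = begin
          fromℕ 3  ≤⟨ 3≤c ⟩
          c        ≤⟨ proj₁ c<εn ⟩
          ε * N    ≤⟨ *-monoʳ-≤ (proj₁ 0<N) ε≤1 ⟩
          1# * N   ≈⟨ *-identityˡ N ⟩
          N        ∎

        half = halving {I = ∃ X} (λ (y , _) i → K (x i) y) 0<n 0≤b (signing n x x∈X)
                 (λ (y , y∈X) i → K≤b (x∈X i) y∈X)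
        S      = proj₁ half
        N≤2M   = proj₁ (proj₂ half)
        2M≤N+1 = proj₁ (proj₂ (proj₂ half))
        errS   = proj₂ (proj₂ (proj₂ half))
        M      = fromℕ (card S)
        F      = B / N

        0<M : 0# < M
        0<M = ≰⇒> λ M≤0 → <⇒≱ 0<N (≤-trans N≤2M (≤-trans (+-mono-≤ M≤0 M≤0) (≤-reflexive (+-identityˡ 0#))))

        0<m : 0 ℕ.< card S
        0<m = ℕ.≰⇒> λ m≤0 → <⇒≱ 0<M (fromℕ-mono m≤0)

        -- The larger half of a single point is that point again, so the descent relies on n ≥ 3.
        m<n : card S ℕ.< n
        m<n = ℕ.≰⇒> λ n≤m → <⇒≱ 0<2 (≤-fromGap
          (+-nonNeg (+-nonNeg (gap 3≤N) (gap 2M≤N+1)) (+-nonNeg (gap (fromℕ-mono n≤m)) (gap (fromℕ-mono n≤m))))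
          (solve 2 (λ M N → :0 :- (:1 :+ :1) :=
             N :- (:1 :+ (:1 :+ (:1 :+ :0))) :+ (N :+ :1 :- (M :+ M)) :+ (M :- N :+ (M :- N))) refl M N))

        rest   = coreset (card S) (smaller m<n) 0<m (λ k → x (enum S k)) (λ k → x∈X (enum S k))
        R      = proj₁ rest
        E      = proj₁ (proj₂ rest)
        0<R    = proj₁ (proj₂ (proj₂ rest))
        εR≤c   = proj₁ (proj₂ (proj₂ (proj₂ rest)))
        errR   = proj₁ (proj₂ (proj₂ (proj₂ (proj₂ rest))))
        slackR = proj₂ (proj₂ (proj₂ (proj₂ (proj₂ rest))))

        slack : E ≤ 0# ⊎ M * E + (B + B) ≤ M * ε → N * (E + F) + (B + B) ≤ N * ε
        slack (inj₁ E≤0) = begin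
          N * (E + F) + (B + B)      ≈⟨ +-congʳ (trans (distribˡ N E F) (+-congˡ (*-/ B 0<N))) ⟩
          N * E + B + (B + B)        ≤⟨ +-monoˡ-≤ (B + B) (+-monoˡ-≤ B (≤-trans (*-monoˡ-≤ (proj₁ 0<N) E≤0) (≤-reflexive (zeroʳ N)))) ⟩
          0# + B + (B + B)           ≈⟨ +-congʳ (+-identityˡ B) ⟩
          B + (B + B)                ≤⟨ 3B≤c ⟩
          c                          ≤⟨ proj₁ c<εn ⟩
          ε * N                      ≈⟨ *-comm ε N ⟩
          N * ε                      ∎
        slack (inj₂ ME+2B≤Mε) = ≤-fromGap
          (gap (slack-halve {δ = ε - E} 0<M 0≤B 3≤N 2M≤N+1 (≤-fromGap (gap ME+2B≤Mε)
            (solve 4 (λ M E ε B → M :* (ε :- E) :- (B :+ B) := M :* ε :- (M :* E :+ (B :+ B))) refl M E ε B))))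
          (begin-equality
            N * ε - (N * (E + F) + (B + B))
              ≈⟨ solve 5 (λ N E F ε B → N :* ε :- (N :* (E :+ F) :+ (B :+ B)) := N :* (ε :- E) :- (N :* F :+ (B :+ B))) refl N E F ε B ⟩
            N * (ε - E) - (N * F + (B + B))
              ≈⟨ +-congˡ (-‿cong (+-congʳ (*-/ B 0<N))) ⟩
            N * (ε - E) - (B + (B + B))  ∎)

    coresetBound : CoresetBound X K c
    coresetBound n x x∈X ε 0<ε ε≤1 =
      let 0<n = ℕ.>-nonZero⁻¹ n
          N   = fromℕ n
          0<N = fromℕ-pos n 0<n
          (S , E , 0<S , εS≤c , err , slack) = coreset 0<ε ε≤1 n (ℕ.<-wellFounded n) 0<n x x∈X
          E≤ε : E ≤ ε
          E≤ε = case slack of λ where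
            (inj₁ E≤0)       → ≤-trans E≤0 (proj₁ 0<ε)
            (inj₂ NE+2B≤Nε)  → *-cancelˡ-≤ 0<N (≤-trans
              (≤-fromGap (+-nonNeg 0≤B 0≤B) (solve 2 (λ x y → x :+ y :- x := y) refl (N * E) (B + B)))
              NE+2B≤Nε)
      in S , card>0⇒Nonempty S 0<S ,
         *-cancelˡ-≤ 0<ε (≤-trans εS≤c (≤-reflexive (sym (*-/ c 0<ε)))) ,
         λ y y∈X → ≤-trans (err y y∈X) E≤ε

  -- Transfer from Tai's kernel to a kernel on a domain

  module Pullback {D} (tai : TaiConstant D) (X : ℝ^ D → Set) (K : ℝ → Kernel D)
    (φ : ℝ → ℝ^ D → ℝ^ D)
    (T∘φ≈K : ∀ {α} → 0# < α → ∀ {x y} → X x → X y → T (φ α y) (φ α x) ≈ K α x y) where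

    open TaiConstant tai using (fT)
    open Tai tai using (0≤fT; ∣T∣≤fT)

    module _ {α} (0<α : 0# < α) where

      signing : ∀ n (x : Fin n → ℝ^ D) → (∀ i → X (x i)) →
                Signing {I = ∃ X} fT (λ (y , _) i → K α (x i) y)
      signing n x x∈X = let (σ , balanced , small) = Tai.signing tai n (λ i → φ α (x i)) in
        σ , balanced , λ (y , y∈X) →
          ∣∣-resp (sum-cong-≋ {n} λ i → *-congˡ (T∘φ≈K 0<α (x∈X i) y∈X)) (small (φ α y))

      signingBound : SigningBound X (K α) (fT + 1#)
      signingBound n x x∈X = let (σ , _ , small) = signing n x x∈X in
        σ , λ y y∈X → ≤-trans (small (y , y∈X))
          (≤-fromGap 0≤1 (solve 1 (λ b → b :+ :1 :- b := :1) refl fT))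

    coresetBound : ∃ λ c → ∀ α → 0# < α → CoresetBound X (K α) c
    -- The witness is `Coreset.c` at b = `fT`, that is 6 `fT` + 3. It unfolds to a term without α,
    -- so it can be fixed before α is given.
    coresetBound = _ , λ α 0<α → Coreset.coresetBound X (K α) fT 0≤fT (signing 0<α)
      λ {x} {y} x∈X y∈X → ∣∣-resp (T∘φ≈K 0<α x∈X y∈X) (∣T∣≤fT (φ α y) (φ α x))

mainTheorem6 :
    (em : ExcludedMiddle 0ℓ) (reals : CompleteOrderedField) →
    let open Analysis em reals in
    (tai : ∀ D → TaiConstant D) →
    let fT : ℕ → ℝ
        fT D = TaiConstant.fT (tai D)
    in
    ∀ d → 1 ℕ.≤ d →
      (∀ α → 0# < α → SigningBound (Sphere d) (exponentialKernel α) (fT (suc d) + 1#))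
      × (∀ α → 0# < α → SigningBound (Simplex d) (hellingerKernel α) (fT d + 1#))
      × (∃ λ c → ∀ α → 0# < α → CoresetBound (Sphere d) (exponentialKernel α) c)
      × (∃ λ c → ∀ α → 0# < α → CoresetBound (Simplex d) (hellingerKernel α) c)
mainTheorem6 em reals tai d _ =
  (λ α 0<α → Exponential.signingBound 0<α) , (λ α 0<α → Hellinger.signingBound 0<α) ,
  Exponential.coresetBound , Hellinger.coresetBound
  where
  open Analysis em reals
  open Development em reals

  module Exponential = Pullback (tai (suc d)) (Sphere d) (λ α → exponentialKernel α)
    (λ α x → √ (α / (1# + 1#)) · x) T-exponential
  module Hellinger = Pullback (tai d) (Simplex d) (λ α → hellingerKernel α)
    (λ α x → √ α · √ᵛ x) (λ 0<α {x} {y} _ _ → T-scaled 0<α (√ᵛ x) (√ᵛ y))
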